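{- $\mathrm{FO}(<,\sqsubset)$ is strictly less expressive than $\mathrm{FO}(\mathrm{Bit})$ on the class of finite structures.
   Context: $\mathbb{N}=\{0,1,2,\dots\}$, $[n]=\{0,\dots,n\}$. For $i\in\mathbb{N}$ let $q_i=i(i+1)/2$; for $x\in\mathbb{N}$ let $c(x)=\max\{i: q_i\le x\}$ and $r(x)=x-q_{c(x)}$. The strict linear order $\sqsubset$ on $\mathbb{N}$ is given by $x\sqsubset y$ iff $r(x)<r(y)$, or $r(x)=r(y)$ and $c(x)<c(y)$. $<$ is the usual order, $\mathrm{Bit}=\{(a,i): 2\nmid\lfloor a/2^i\rfloor\}$. For a numerical predicate $P\subseteq\mathbb{N}^k$, $P^n=P\cap[n]^k$; $\mathrm{FO}(\ell)$ is first-order logic over finite structures with universe $[n]$ (some $n$), each predicate $P$ in $\ell$ interpreted by $P^n$. "Strictly less expressive" means every $\mathrm{FO}(<,\sqsubset)$-sentence is equivalent on all such finite structures to an $\mathrm{FO}(\mathrm{Bit})$-sentence, but not conversely. -}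

module Defs where

open import Data.Nat using (ℕ; zero; suc; _+_; _*_; _∸_; _^_; _<ᵇ_; _≤ᵇ_; _≡ᵇ_)
open import Data.Nat.DivMod using (_/_; _%_)
open import Data.Nat.Properties using (m^n≢0)
open import Data.Bool using (Bool; true; false; not; _∧_; _∨_; if_then_else_)
open import Data.Fin using (Fin; toℕ) renaming (zero to fz; suc to fs)
open import Data.List using (List; []; _∷_; length; lookup)
open import Data.Vec using (Vec; []; _∷_; map)
open import Data.Product using (Σ; _×_; _,_)
open import Relation.Binary.PropositionalEquality using (_≡_)

q : ℕ → ℕ
q i = (i * suc i) / 2

-- largest i ≤ k with q i ≤ x  (q 0 = 0 ≤ x always)
cSearch : ℕ → ℕ → ℕ
cSearch x zero    = zero
cSearch x (suc i) = if q (suc i) ≤ᵇ x then suc i else cSearch x i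

-- c x = max { i : q i ≤ x }  (such i satisfy i ≤ q i ≤ x, so search up to x)
c : ℕ → ℕ
c x = cSearch x x

r : ℕ → ℕ
r x = x ∸ q (c x)

_⊏ᵇ_ : ℕ → ℕ → Bool
x ⊏ᵇ y = (r x <ᵇ r y) ∨ ((r x ≡ᵇ r y) ∧ (c x <ᵇ c y))

bitᵇ : ℕ → ℕ → Bool
bitᵇ a i = ((a / (2 ^ i)) {{m^n≢0 2 i}} % 2) ≡ᵇ 1

record NumSig : Set where
  field
    arities : List ℕ
    interp  : (i : Fin (length arities)) → Vec ℕ (lookup arities i) → Bool
open NumSig public

LtSq : NumSig
LtSq = record { arities = 2 ∷ 2 ∷ [] ; interp = I }
  where
  I : (i : Fin 2) → Vec ℕ (lookup (2 ∷ 2 ∷ []) i) → Bool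
  I fz      (x ∷ y ∷ []) = x <ᵇ y
  I (fs fz) (x ∷ y ∷ []) = x ⊏ᵇ y

BitSig : NumSig
BitSig = record { arities = 2 ∷ [] ; interp = I }
  where
  I : (i : Fin 1) → Vec ℕ (lookup (2 ∷ []) i) → Bool
  I fz (a ∷ i ∷ []) = bitᵇ a i

Vocab : Set
Vocab = List ℕ

data Formula (σ : Vocab) (N : NumSig) (m : ℕ) : Set where
  eq   : Fin m → Fin m → Formula σ N m
  rel  : (i : Fin (length σ)) → Vec (Fin m) (lookup σ i) → Formula σ N m
  num  : (i : Fin (length (arities N))) → Vec (Fin m) (lookup (arities N) i) → Formula σ N m
  neg  : Formula σ N m → Formula σ N m
  conj : Formula σ N m → Formula σ N m → Formula σ N m
  ex   : Formula σ N (suc m) → Formula σ N m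

Sentence : Vocab → NumSig → Set
Sentence σ N = Formula σ N zero

-- A finite σ-structure with universe [n] = {0,…,n} (represented as Fin (suc n))
Structure : Vocab → ℕ → Set
Structure σ n = (i : Fin (length σ)) → Vec (Fin (suc n)) (lookup σ i) → Bool

anyFin : (k : ℕ) → (Fin k → Bool) → Bool
anyFin zero    f = false
anyFin (suc k) f = f fz ∨ anyFin k (λ j → f (fs j))

extend : {m n : ℕ} → (Fin m → Fin (suc n)) → Fin (suc n) → Fin (suc m) → Fin (suc n)
extend ρ a fz     = a
extend ρ a (fs j) = ρ j

eqFin : {k : ℕ} → Fin k → Fin k → Bool
eqFin a b = toℕ a ≡ᵇ toℕ b

eval : {σ : Vocab} {N : NumSig} {m : ℕ} (n : ℕ) → Structure σ n →
       (Fin m → Fin (suc n)) → Formula σ N m → Bool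
eval n A ρ (eq x y)     = eqFin (ρ x) (ρ y)
eval n A ρ (rel i xs)   = A i (map ρ xs)
eval {N = N} n A ρ (num i xs) = interp N i (map (λ x → toℕ (ρ x)) xs)
eval n A ρ (neg φ)      = not (eval n A ρ φ)
eval n A ρ (conj φ ψ)   = eval n A ρ φ ∧ eval n A ρ ψ
eval n A ρ (ex φ)       = anyFin (suc n) (λ a → eval n A (extend ρ a) φ)

noVar : {n : ℕ} → Fin zero → Fin (suc n)
noVar ()

_⊨_ : {σ : Vocab} {N : NumSig} {n : ℕ} → Structure σ n → Sentence σ N → Bool
_⊨_ {n = n} A φ = eval n A noVar φ

Equivalent : {σ : Vocab} {N M : NumSig} → Sentence σ N → Sentence σ M → Set
Equivalent {σ} φ ψ = (n : ℕ) (A : Structure σ n) → (A ⊨ φ) ≡ (A ⊨ ψ)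

{-# OPTIONS --safe #-}
module Submission where

-- Reading i ∈ a for Bit(a, i), the elements of [n] are the subsets of the positions below log n, up to one bit, so
-- FO(Bit) quantifies over such sets.  On positions of positions, < is the only relation that satisfies the recursion
-- "compare at the largest element of the symmetric difference", and its chain of initial segments is coded by an
-- element of [n]; two more rounds of the recursion define < on [n].  Addition guesses the set of carries.  For
-- multiplication, the column sums and then the carries are paths of about log n states with O(log log n) bits each.
-- A path of √(log n) states fits into one element, so a path of such paths, defined by iterating the same
-- construction, is long enough.  Multiplication gives x = q i + s, hence c, r and ⊏; the finitely many n below a
-- threshold are treated by listing pairs of numerals.
-- For strictness, place x in row c x and column r x of a triangle.  Both orders are lexicographic in (c x, r x), up to
-- the order of the two coordinates, so the duplicator wins the game on two triangles with enough rows by playing on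
-- the linear orders of row numbers.  Hence FO(<, ⊏) cannot tell apart the triangles with 4t and with 4t + 1 rows,
-- whose maximal elements differ in parity.

open import Defs
open import Data.Product using (Σ; _×_; ∃; _,_; proj₁; proj₂; swap)
open import Relation.Nullary using (¬_; Dec; yes; no)
open import Data.Bool using (Bool; true; false; not; _∧_; _∨_; T)
open import Data.Bool.Properties using (¬-not)
open import Data.Empty using (⊥; ⊥-elim)
open import Data.Fin using (Fin; toℕ; fromℕ<) renaming (zero to fz; suc to fs)
open import Data.Fin.Properties using (toℕ-fromℕ<; toℕ<n)
open import Data.List using (List; []; _∷_; map; filter)
open import Data.List.Extrema.Nat using (argmax; argmin; argmax-sel; argmin-sel; f[xs]≤f[argmax]; f[argmin]≤f[xs])
import Data.List.Relation.Unary.All as All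
open import Data.List.Relation.Unary.Any using (here; there)
open import Data.List.Membership.Propositional using (_∈_)
open import Data.List.Membership.Propositional.Properties using (∈-filter⁺; ∈-filter⁻; ∈-map⁺; ∈-map⁻)
open import Data.Nat using (ℕ; zero; suc; pred; _+_; _*_; _∸_; _^_; _⊓_; _≤_; _<_; z≤n; s≤s; NonZero; >-nonZero; ≢-nonZero⁻¹; _<ᵇ_; _≤ᵇ_; _≡ᵇ_; _≤?_; _<?_; _≟_)
open import Data.Nat.DivMod
open import Data.Nat.Divisibility using (n∣m*n)
open import Data.Nat.Properties
open import Data.Nat.Tactic.RingSolver using (solve-∀)
open import Data.Sum using (_⊎_; inj₁; inj₂)
open import Data.Vec using ([]; _∷_)
open import Function using (_∘_; id)
open import Relation.Binary.Definitions using (tri<; tri≈; tri>)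
open import Relation.Binary.PropositionalEquality

-- Binary expansions

b2n : Bool → ℕ
b2n true  = 1
b2n false = 0

b2n≤1 : ∀ b → b2n b ≤ 1
b2n≤1 true  = ≤-refl
b2n≤1 false = z≤n

b2n-injective : ∀ {a b} → b2n a ≡ b2n b → a ≡ b
b2n-injective {true}  {true}  _ = refl
b2n-injective {false} {false} _ = refl

bool-ext : ∀ {a b : Bool} → (a ≡ true → b ≡ true) → (b ≡ true → a ≡ true) → a ≡ b
bool-ext {true}  {b}     f g = sym (f refl)
bool-ext {false} {false} f g = refl
bool-ext {false} {true}  f g = g refl

absurd : ∀ {A : Set} → true ≡ false → A
absurd ()

T⇒≡ : ∀ {b} → T b → b ≡ true
T⇒≡ {true} _ = refl

≡⇒T : ∀ {b} → b ≡ true → T b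
≡⇒T refl = _

bit-suc : ∀ a i → bitᵇ a (suc i) ≡ bitᵇ (a / 2) i
bit-suc a i = cong (λ t → (t % 2) ≡ᵇ 1) (sym (m/n/o≡m/[n*o] a 2 (2 ^ i) {{_}} {{m^n≢0 2 i}} {{m^n≢0 2 (suc i)}}))

%2-bit : ∀ m → m < 2 → m ≡ b2n (m ≡ᵇ 1)
%2-bit 0 _ = refl
%2-bit 1 _ = refl
%2-bit (suc (suc _)) (s≤s (s≤s ()))

dig : ℕ → ℕ → ℕ
dig a i = b2n (bitᵇ a i)

dig≡ : ∀ a i → ((a / (2 ^ i)) {{m^n≢0 2 i}} % 2) ≡ dig a i
dig≡ a i = %2-bit _ (m%n<n ((a / (2 ^ i)) {{m^n≢0 2 i}}) 2)

half-split : ∀ a → a ≡ dig a 0 + 2 * (a / 2)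
half-split a = begin
  a                       ≡⟨ m≡m%n+[m/n]*n a 2 ⟩
  a % 2 + a / 2 * 2       ≡⟨ cong₂ _+_ (trans (cong (_% 2) (sym (n/1≡n a))) (dig≡ a 0)) (*-comm (a / 2) 2) ⟩
  dig a 0 + 2 * (a / 2)   ∎
  where open ≡-Reasoning

double-% : ∀ b a → (b2n b + 2 * a) % 2 ≡ b2n b
double-% b a = trans (cong (λ t → (b2n b + t) % 2) (*-comm 2 a)) (trans ([m+kn]%n≡m%n (b2n b) a 2) (m<n⇒m%n≡m (s≤s (b2n≤1 b))))

double-bit₀ : ∀ b a → bitᵇ (b2n b + 2 * a) 0 ≡ b
double-bit₀ b a = b2n-injective (trans (sym (dig≡ x 0)) (trans (cong (_% 2) (n/1≡n x)) (double-% b a)))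
  where x = b2n b + 2 * a

double-/ : ∀ b a → (b2n b + 2 * a) / 2 ≡ a
double-/ b a = *-cancelˡ-≡ _ _ 2 (+-cancelˡ-≡ (b2n b) _ _
  (trans (cong (λ t → b2n t + 2 * (x / 2)) (sym (double-bit₀ b a))) (sym (half-split x))))
  where x = b2n b + 2 * a

double-bitₛ : ∀ b a i → bitᵇ (b2n b + 2 * a) (suc i) ≡ bitᵇ a i
double-bitₛ b a i = trans (bit-suc (b2n b + 2 * a) i) (cong (λ t → bitᵇ t i) (double-/ b a))

-- i ∈ a in Ackermann's coding of hereditarily finite sets; a record, so that a and i can be inferred.
infix 4 _∋_
record _∋_ (a i : ℕ) : Set where
  constructor one
  field isOne : bitᵇ a i ≡ true
open _∋_ public

_∋?_ : ∀ a i → Dec (a ∋ i)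
a ∋? i with bitᵇ a i in e
... | true  = yes (one e)
... | false = no λ h → absurd (trans (sym (isOne h)) e)

∌⇒false : ∀ {a i} → ¬ (a ∋ i) → bitᵇ a i ≡ false
∌⇒false h = ¬-not λ e → h (one e)

false⇒∌ : ∀ {a i} → bitᵇ a i ≡ false → ¬ (a ∋ i)
false⇒∌ e h = absurd (trans (sym (isOne h)) e)

∋-ext : ∀ a i b j → (a ∋ i → b ∋ j) → (b ∋ j → a ∋ i) → bitᵇ a i ≡ bitᵇ b j
∋-ext _ _ _ _ f g = bool-ext (λ h → isOne (f (one h))) (λ h → isOne (g (one h)))

bit⇒2^≤ : ∀ {a i} → a ∋ i → 2 ^ i ≤ a
bit⇒2^≤ {a} {i} (one h) with 2 ^ i ≤? a
... | yes p = p
... | no ¬p = absurd (trans (sym h) (cong (λ t → (t % 2) ≡ᵇ 1) (m<n⇒m/n≡0 {{m^n≢0 2 i}} (≰⇒> ¬p))))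

n<2^n : ∀ n → n < 2 ^ n
n<2^n zero    = s≤s z≤n
n<2^n (suc n) = begin-strict
  suc n           ≤⟨ n<2^n n ⟩
  2 ^ n           <⟨ m<m+n (2 ^ n) (m^n>0 2 n) ⟩
  2 ^ n + 2 ^ n   ≡⟨ cong (2 ^ n +_) (sym (+-identityʳ _)) ⟩
  2 ^ suc n       ∎
  where open ≤-Reasoning

bit⇒< : ∀ {a i} → a ∋ i → i < a
bit⇒< {a} {i} h = <-≤-trans (n<2^n i) (bit⇒2^≤ h)

bit-high : ∀ a i → a < 2 ^ i → bitᵇ a i ≡ false
bit-high a i a< = ∌⇒false {a} {i} λ h → <⇒≱ a< (bit⇒2^≤ h)

<2^suc⇒half : ∀ a m → a < 2 ^ suc m → a / 2 < 2 ^ m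
<2^suc⇒half a m h = m<n*o⇒m/o<n (subst (a <_) (*-comm 2 (2 ^ m)) h)

bit-ext-below : ∀ m a b → a < 2 ^ m → b < 2 ^ m → (∀ i → bitᵇ a i ≡ bitᵇ b i) → a ≡ b
bit-ext-below zero    zero zero _ _ _ = refl
bit-ext-below zero    (suc _) _ (s≤s ()) _ _
bit-ext-below zero    zero (suc _) _ (s≤s ()) _
bit-ext-below (suc m) a b a< b< h = begin
  a                      ≡⟨ half-split a ⟩
  dig a 0 + 2 * (a / 2)  ≡⟨ cong₂ (λ s t → b2n s + 2 * t) (h 0)
                             (bit-ext-below m _ _ (<2^suc⇒half a m a<) (<2^suc⇒half b m b<)
                               (λ i → trans (sym (bit-suc a i)) (trans (h (suc i)) (bit-suc b i)))) ⟩
  dig b 0 + 2 * (b / 2)  ≡⟨ half-split b ⟨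
  b                      ∎
  where open ≡-Reasoning

bit-ext : ∀ a b → (∀ i → bitᵇ a i ≡ bitᵇ b i) → a ≡ b
bit-ext a b = bit-ext-below (a + b) a b
  (<-≤-trans (n<2^n a) (^-monoʳ-≤ 2 (m≤m+n a b))) (<-≤-trans (n<2^n b) (^-monoʳ-≤ 2 (m≤n+m b a)))

-- The bound `2 ^ m` is what places a guessed set inside [n]: for m = ⌊log₂ n⌋ every set of
-- positions below m is an element.
comprehension : ∀ m (g : ℕ → Bool) → ∃ λ a → a < 2 ^ m × (∀ i → i < m → bitᵇ a i ≡ g i) × (∀ i → a ∋ i → i < m)
comprehension zero g = 0 , s≤s z≤n , (λ _ ()) , λ i h → ⊥-elim (n≮0 (bit⇒< h))
comprehension (suc m) g with comprehension m (λ i → g (suc i))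
... | a , a< , in-range , out = x , x< , f , o
  where
  x = b2n (g 0) + 2 * a
  x< : x < 2 ^ suc m
  x< = begin-strict
    b2n (g 0) + 2 * a  <⟨ s≤s (+-monoˡ-≤ (2 * a) (b2n≤1 (g 0))) ⟩
    2 + 2 * a          ≡⟨ sym (*-suc 2 a) ⟩
    2 * suc a          ≤⟨ *-monoʳ-≤ 2 a< ⟩
    2 ^ suc m          ∎
    where open ≤-Reasoning
  f : ∀ i → i < suc m → bitᵇ x i ≡ g i
  f zero    _ = double-bit₀ (g 0) a
  f (suc i) (s≤s i<) = trans (double-bitₛ (g 0) a i) (in-range i i<)
  o : ∀ i → x ∋ i → i < suc m
  o zero    _ = s≤s z≤n
  o (suc i) h = s≤s (out i (one (trans (sym (double-bitₛ (g 0) a i)) (isOne h))))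

-- The order is decided by the highest bit in which two numbers differ.
TopBit : ℕ → ℕ → Set
TopBit a b = ∃ λ i → bitᵇ b i ≡ true × bitᵇ a i ≡ false × (∀ j → i < j → bitᵇ a j ≡ bitᵇ b j)

-- Halving moves the deciding bit down to 0, where the halves coincide by extensionality; above 0
-- the strict gain in the halves, doubled, outweighs bit 0.
topBit⇒<′ : ∀ i a b → bitᵇ b i ≡ true → bitᵇ a i ≡ false → (∀ j → i < j → bitᵇ a j ≡ bitᵇ b j) → a < b
topBit⇒<′ zero a b bi ai h = begin-strict
  a                      ≡⟨ half-split a ⟩
  dig a 0 + 2 * (a / 2)  ≡⟨ cong₂ (λ s t → b2n s + 2 * t) ai (bit-ext _ _ λ i → trans (sym (bit-suc a i)) (trans (h (suc i) (s≤s z≤n)) (bit-suc b i))) ⟩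
  2 * (b / 2)            <⟨ n<1+n _ ⟩
  1 + 2 * (b / 2)        ≡⟨ cong (λ s → b2n s + 2 * (b / 2)) (sym bi) ⟩
  dig b 0 + 2 * (b / 2)  ≡⟨ half-split b ⟨
  b                      ∎
  where open ≤-Reasoning
topBit⇒<′ (suc i) a b bi ai h = begin-strict
  a                      ≡⟨ half-split a ⟩
  dig a 0 + 2 * (a / 2)  <⟨ s≤s (+-monoˡ-≤ (2 * (a / 2)) (b2n≤1 (bitᵇ a 0))) ⟩
  2 + 2 * (a / 2)        ≡⟨ sym (*-suc 2 (a / 2)) ⟩
  2 * suc (a / 2)        ≤⟨ *-monoʳ-≤ 2 ih ⟩
  2 * (b / 2)            ≤⟨ m≤n+m _ (dig b 0) ⟩
  dig b 0 + 2 * (b / 2)  ≡⟨ half-split b ⟨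
  b                      ∎
  where
  open ≤-Reasoning
  ih : a / 2 < b / 2
  ih = topBit⇒<′ i (a / 2) (b / 2) (trans (sym (bit-suc b i)) bi) (trans (sym (bit-suc a i)) ai)
         (λ j i<j → trans (sym (bit-suc a j)) (trans (h (suc j) (s≤s i<j)) (bit-suc b j)))

topBit⇒< : ∀ a b → TopBit a b → a < b
topBit⇒< a b (i , bi , ai , h) = topBit⇒<′ i a b bi ai h

<⇒topBit-below : ∀ m a b → b < 2 ^ m → a < b → TopBit a b
<⇒topBit-below zero a (suc b) (s≤s ()) _
<⇒topBit-below zero a zero _ ()
<⇒topBit-below (suc m) a b b< a<b with <-cmp (a / 2) (b / 2)
... | tri< lt _ _ with <⇒topBit-below m (a / 2) (b / 2) (<2^suc⇒half b m b<) lt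
...   | i , bi , ai , h = suc i , trans (bit-suc b i) bi , trans (bit-suc a i) ai , h′
  where
  h′ : ∀ j → suc i < j → bitᵇ a j ≡ bitᵇ b j
  h′ (suc j) (s≤s i<j) = trans (bit-suc a j) (trans (h j i<j) (sym (bit-suc b j)))
<⇒topBit-below (suc m) a b b< a<b | tri> _ _ gt = ⊥-elim (<⇒≱ a<b (≮⇒≥ λ _ → <⇒≱ gt (/-monoˡ-≤ 2 (<⇒≤ a<b))))
<⇒topBit-below (suc m) a b b< a<b | tri≈ _ a≡b _ with bitᵇ a 0 in ea | bitᵇ b 0 in eb
... | false | true = 0 , eb , ea , h′
  where
  h′ : ∀ j → 0 < j → bitᵇ a j ≡ bitᵇ b j
  h′ (suc j) _ = trans (bit-suc a j) (trans (cong (λ t → bitᵇ t j) a≡b) (sym (bit-suc b j)))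
... | true | _ = ⊥-elim (<⇒≱ a<b (begin
  b                      ≡⟨ half-split b ⟩
  dig b 0 + 2 * (b / 2)  ≤⟨ +-mono-≤ (b2n≤1 (bitᵇ b 0)) (≤-reflexive (cong (2 *_) (sym a≡b))) ⟩
  1 + 2 * (a / 2)        ≡⟨ cong (λ s → b2n s + 2 * (a / 2)) (sym ea) ⟩
  dig a 0 + 2 * (a / 2)  ≡⟨ half-split a ⟨
  a                      ∎))
  where open ≤-Reasoning
... | false | false = ⊥-elim (<⇒≱ a<b (begin
  b                      ≡⟨ half-split b ⟩
  dig b 0 + 2 * (b / 2)  ≡⟨ cong₂ (λ s t → b2n s + 2 * t) eb (sym a≡b) ⟩
  2 * (a / 2)            ≤⟨ m≤n+m _ (dig a 0) ⟩
  dig a 0 + 2 * (a / 2)  ≡⟨ half-split a ⟨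
  a                      ∎))
  where open ≤-Reasoning

<⇒topBit : ∀ a b → a < b → TopBit a b
<⇒topBit a b = <⇒topBit-below b a b (n<2^n b)

-- Definability in FO(Bit)

infix 1 _⟺_
_⟺_ : Set → Set → Set
A ⟺ B = (A → B) × (B → A)

⟺-trans : ∀ {A B C} → A ⟺ B → B ⟺ C → A ⟺ C
⟺-trans (f , f′) (g , g′) = g ∘ f , f′ ∘ g′

⟺-sym : ∀ {A B} → A ⟺ B → B ⟺ A
⟺-sym (f , g) = g , f

true⟺⇒≡ : ∀ {a b : Bool} → (a ≡ true) ⟺ (b ≡ true) → a ≡ b
true⟺⇒≡ (f , g) = bool-ext f g

≡ᵇ-true : ∀ x y → ((x ≡ᵇ y) ≡ true) ⟺ (x ≡ y)
≡ᵇ-true x y = (λ e → ≡ᵇ⇒≡ x y (≡⇒T e)) , λ e → T⇒≡ (≡⇒≡ᵇ x y e)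

<ᵇ-true : ∀ x y → ((x <ᵇ y) ≡ true) ⟺ (x < y)
<ᵇ-true x y = (λ e → <ᵇ⇒< x y (≡⇒T e)) , λ lt → T⇒≡ (<⇒<ᵇ lt)

∃≤ : ℕ → (ℕ → Set) → Set
∃≤ n P = ∃ λ a → a ≤ n × P a

∀≤ : ℕ → (ℕ → Set) → Set
∀≤ n P = ∀ a → a ≤ n → P a

anyFin-true : ∀ k f → (anyFin k f ≡ true) ⟺ (∃ λ i → f i ≡ true)
anyFin-true zero f = (λ ()) , λ ()
anyFin-true (suc k) f with f fz in e
... | true  = (λ _ → fz , e) , λ _ → refl
... | false = (λ h → let (i , p) = proj₁ (anyFin-true k (f ∘ fs)) h in fs i , p) , back
  where
  back : (∃ λ i → f i ≡ true) → anyFin k (f ∘ fs) ≡ true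
  back (fz   , p) with trans (sym p) e
  ... | ()
  back (fs i , p) = proj₂ (anyFin-true k (f ∘ fs)) (i , p)

ext : ∀ {m} → (Fin m → ℕ) → ℕ → Fin (suc m) → ℕ
ext e a fz     = a
ext e a (fs i) = e i

Pred : ℕ → Set₁
Pred m = ℕ → (Fin m → ℕ) → Set

-- Environments of predicates take values in ℕ, and correctness is asked for every e that agrees with toℕ ∘ ρ,
-- so that predicates need not respect pointwise equality of environments.
record Def (σ : Vocab) (n₀ m : ℕ) (P : Pred m) : Set where
  constructor def
  field
    formula : Formula σ BitSig m
    correct : ∀ n → n₀ ≤ n → (A : Structure σ n) (ρ : Fin m → Fin (suc n)) (e : Fin m → ℕ) →
              (∀ i → toℕ (ρ i) ≡ e i) → (eval n A ρ formula ≡ true) ⟺ P n e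
open Def public

module _ {σ : Vocab} {n₀ : ℕ} {m : ℕ} where

  -- The equivalence is asked only for n above the threshold and environments inside [n], so range
  -- conditions come for free in later definitions.
  respᵈ : {P Q : Pred m} → (∀ n e → n₀ ≤ n → (∀ i → e i ≤ n) → P n e ⟺ Q n e) → Def σ n₀ m P → Def σ n₀ m Q
  respᵈ h (def φ ok) = def φ λ n n₀≤ A ρ e eq → ⟺-trans (ok n n₀≤ A ρ e eq)
    (h n e n₀≤ λ i → subst (_≤ n) (eq i) (<⇒≤pred (toℕ<n (ρ i))))

  eqᵈ : (x y : Fin m) → Def σ n₀ m (λ n e → e x ≡ e y)
  eqᵈ x y = def (eq x y) λ n _ A ρ e h →
    (λ t → trans (sym (h x)) (trans (proj₁ (≡ᵇ-true (toℕ (ρ x)) (toℕ (ρ y))) t) (h y))) ,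
    (λ t → proj₂ (≡ᵇ-true (toℕ (ρ x)) (toℕ (ρ y))) (trans (h x) (trans t (sym (h y)))))

  bitᵈ : (x y : Fin m) → Def σ n₀ m (λ n e → (e x) ∋ (e y))
  bitᵈ x y = def (num fz (x ∷ y ∷ [])) λ n _ A ρ e h →
    let p = cong₂ bitᵇ (h x) (h y) in (λ t → one (trans (sym p) t)) , λ t → trans p (isOne t)

  ¬ᵈ : {P : Pred m} → Def σ n₀ m P → Def σ n₀ m (λ n e → ¬ P n e)
  ¬ᵈ (def φ ok) = def (neg φ) λ n n₀≤ A ρ e h → lemma (ok n n₀≤ A ρ e h)
    where
    lemma : ∀ {b : Bool} {X : Set} → (b ≡ true) ⟺ X → (not b ≡ true) ⟺ (¬ X)
    lemma {true}  (f , g) = (λ ()) , λ nx → ⊥-elim (nx (f refl))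
    lemma {false} (f , g) = (λ _ x → absurd (sym (g x))) , λ _ → refl

  infixr 6 _×ᵈ_
  infixr 5 _⊎ᵈ_
  infixr 4 _→ᵈ_

  _×ᵈ_ : {P Q : Pred m} → Def σ n₀ m P → Def σ n₀ m Q → Def σ n₀ m (λ n e → P n e × Q n e)
  def φ ok ×ᵈ def ψ ok′ = def (conj φ ψ) λ n n₀≤ A ρ e h → lemma (ok n n₀≤ A ρ e h) (ok′ n n₀≤ A ρ e h)
    where
    lemma : ∀ {b c : Bool} {X Y : Set} → (b ≡ true) ⟺ X → (c ≡ true) ⟺ Y → (b ∧ c ≡ true) ⟺ (X × Y)
    lemma {true}  (f , g) (f′ , g′) = (λ t → f refl , f′ t) , λ { (x , y) → g′ y }
    lemma {false} (f , g) _ = (λ ()) , λ { (x , y) → g x }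

  -- Evaluating the formula decides the predicate; as `P` does not mention the structure, any
  -- structure will do. This justifies the classical definitions of ∨, → and ∀ from ¬, ∧ and ∃.
  decide : {P : Pred m} → Def σ n₀ m P → ∀ n e → n₀ ≤ n → (∀ i → e i ≤ n) → Dec (P n e)
  decide (def φ ok) n e n₀≤ bnd with ok n n₀≤ (λ _ _ → true) (λ i → fromℕ< (s≤s (bnd i))) e (λ i → toℕ-fromℕ< (s≤s (bnd i)))
  ... | f , g with eval n (λ _ _ → true) (λ i → fromℕ< (s≤s (bnd i))) φ
  ... | true  = yes (f refl)
  ... | false = no λ p → absurd (sym (g p))

  _⊎ᵈ_ : {P Q : Pred m} → Def σ n₀ m P → Def σ n₀ m Q → Def σ n₀ m (λ n e → P n e ⊎ Q n e)
  _⊎ᵈ_ {P} {Q} p q = respᵈ (λ n e n₀≤ bnd → to n e n₀≤ bnd , λ { (inj₁ x) (nx , _) → nx x ; (inj₂ y) (_ , ny) → ny y })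
                  (¬ᵈ (¬ᵈ p ×ᵈ ¬ᵈ q))
    where
    to : ∀ n e → n₀ ≤ n → (∀ i → e i ≤ n) → ¬ (¬ P n e × ¬ Q n e) → P n e ⊎ Q n e
    to n e n₀≤ bnd h with decide p n e n₀≤ bnd | decide q n e n₀≤ bnd
    ... | yes x | _     = inj₁ x
    ... | no _  | yes y = inj₂ y
    ... | no nx | no ny = ⊥-elim (h (nx , ny))

  _→ᵈ_ : {P Q : Pred m} → Def σ n₀ m P → Def σ n₀ m Q → Def σ n₀ m (λ n e → P n e → Q n e)
  _→ᵈ_ {P} {Q} p q = respᵈ (λ n e n₀≤ bnd → to n e n₀≤ bnd , λ { f (x , ny) → ny (f x) }) (¬ᵈ (p ×ᵈ ¬ᵈ q))
    where
    to : ∀ n e → n₀ ≤ n → (∀ i → e i ≤ n) → ¬ (P n e × ¬ Q n e) → P n e → Q n e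
    to n e n₀≤ bnd h x with decide q n e n₀≤ bnd
    ... | yes y = y
    ... | no ny = ⊥-elim (h (x , ny))

  _⟺ᵈ_ : {P Q : Pred m} → Def σ n₀ m P → Def σ n₀ m Q → Def σ n₀ m (λ n e → P n e ⟺ Q n e)
  p ⟺ᵈ q = (p →ᵈ q) ×ᵈ (q →ᵈ p)

  ∃ᵈ : {P : Pred (suc m)} → Def σ n₀ (suc m) P → Def σ n₀ m (λ n e → ∃≤ n λ a → P n (ext e a))
  ∃ᵈ {P} (def φ ok) = def (ex φ) λ n n₀≤ A ρ e h → to n n₀≤ A ρ e h , from n n₀≤ A ρ e h
    where
    agree : ∀ n (ρ : Fin m → Fin (suc n)) e → (∀ i → toℕ (ρ i) ≡ e i) → ∀ a k → toℕ a ≡ k →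
            ∀ i → toℕ (extend ρ a i) ≡ ext e k i
    agree n ρ e h a k p fz     = p
    agree n ρ e h a k p (fs i) = h i
    to : ∀ n → n₀ ≤ n → ∀ A ρ e → (∀ i → toℕ (ρ i) ≡ e i) → eval n A ρ (ex φ) ≡ true → ∃≤ n λ a → P n (ext e a)
    to n n₀≤ A ρ e h t with proj₁ (anyFin-true (suc n) (λ a → eval n A (extend ρ a) φ)) t
    ... | a , p = toℕ a , <⇒≤pred (toℕ<n a) , proj₁ (ok n n₀≤ A (extend ρ a) _ (agree n ρ e h a _ refl)) p
    from : ∀ n → n₀ ≤ n → ∀ A ρ e → (∀ i → toℕ (ρ i) ≡ e i) → (∃≤ n λ a → P n (ext e a)) → eval n A ρ (ex φ) ≡ true
    from n n₀≤ A ρ e h (k , k≤ , p) = proj₂ (anyFin-true (suc n) (λ a → eval n A (extend ρ a) φ))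
      (a , proj₂ (ok n n₀≤ A (extend ρ a) _ (agree n ρ e h a k (toℕ-fromℕ< (s≤s k≤)))) p)
      where a = fromℕ< (s≤s k≤)

module _ {σ : Vocab} {n₀ : ℕ} {m : ℕ} where

  ∀ᵈ : {P : Pred (suc m)} → Def σ n₀ (suc m) P → Def σ n₀ m (λ n e → ∀≤ n λ a → P n (ext e a))
  ∀ᵈ {P} p = respᵈ (λ n e n₀≤ bnd → to n e n₀≤ bnd , λ { f (a , a≤ , nx) → nx (f a a≤) }) (¬ᵈ (∃ᵈ (¬ᵈ p)))
    where
    to : ∀ n e → n₀ ≤ n → (∀ i → e i ≤ n) → ¬ (∃≤ n λ a → ¬ P n (ext e a)) → ∀≤ n λ a → P n (ext e a)
    to n e n₀≤ bnd h a a≤ with decide p n (ext e a) n₀≤ (λ { fz → a≤ ; (fs i) → bnd i })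
    ... | yes x = x
    ... | no nx = ⊥-elim (h (a , a≤ , nx))

  constᵈ : {X : Set} → Dec X → Def σ n₀ m (λ _ _ → X)
  constᵈ (yes x) = respᵈ (λ _ _ _ _ → (λ _ → x) , λ _ → 0 , z≤n , refl) (∃ᵈ (eqᵈ fz fz))
  constᵈ (no ¬x) = respᵈ (λ _ _ _ _ → (λ h → ⊥-elim (h (0 , z≤n , refl))) , λ x → ⊥-elim (¬x x)) (¬ᵈ (∃ᵈ (eqᵈ fz fz)))

pattern v₀ = fz
pattern v₁ = fs fz
pattern v₂ = fs (fs fz)
pattern v₃ = fs (fs (fs fz))
pattern v₄ = fs (fs (fs (fs fz)))

↑² : ∀ {m} → Fin m → Fin (suc (suc m))
↑² x = fs (fs x)

↑³ : ∀ {m} → Fin m → Fin (suc (suc (suc m)))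
↑³ x = fs (fs (fs x))

↑⁴ : ∀ {m} → Fin m → Fin (suc (suc (suc (suc m))))
↑⁴ x = fs (fs (fs (fs x)))

floor-log : ∀ b x → 2 ≤ b → 1 ≤ x → ∃ λ k → b ^ k ≤ x × x < b ^ suc k
floor-log b (suc zero)    2≤b _ = 0 , ≤-refl , <-≤-trans 2≤b (≤-reflexive (sym (*-identityʳ b)))
floor-log b (suc (suc x)) 2≤b _ with floor-log b (suc x) 2≤b (s≤s z≤n)
... | k , lo , hi with suc (suc x) <? b ^ suc k
... | yes lt = k , ≤-trans lo (n≤1+n _) , lt
... | no ≮   = suc k , ≮⇒≥ ≮ , ≤-<-trans hi
                 (subst (b ^ suc k <_) (*-comm (b ^ suc k) b) (m<m*n (b ^ suc k) b {{>-nonZero (≤-<-trans z≤n hi)}} 2≤b))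

-- Defining <

-- Ackermann's reading of numbers as hereditarily finite sets: TopBit describes < on sets through < on their elements.
Less : ℕ → (ℕ → ℕ → Set) → ℕ → ℕ → Set
Less n R a b = ∃≤ n λ i → (b ∋ i × ¬ (a ∋ i)) ×
               ∀≤ n λ j → R i j → (a ∋ j) ⟺ (b ∋ j)

Bits : ℕ → ℕ → ℕ → Set
Bits a b i = a ∋ i ⊎ b ∋ i

-- `R` has to be correct only on the bits of `a` and `b`, since the two numbers agree trivially at
-- all other positions.
Less⟺< : ∀ n R a b → a ≤ n → b ≤ n →
         (∀ i j → Bits a b i → Bits a b j → R i j ⟺ (i < j)) → Less n R a b ⟺ (a < b)
Less⟺< n R a b a≤ b≤ agree = to , from
  where
  to : Less n R a b → a < b
  to (i , i≤ , (bi , ai) , h) = topBit⇒< a b (i , isOne bi , ∌⇒false ai , λ j i<j → ∋-ext a j b j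
    (λ aj → proj₁ (h j (≤-trans (<⇒≤ (bit⇒< aj)) a≤) (proj₂ (agree i j (inj₂ bi) (inj₁ aj)) i<j)) aj)
    (λ bj → proj₂ (h j (≤-trans (<⇒≤ (bit⇒< bj)) b≤) (proj₂ (agree i j (inj₂ bi) (inj₂ bj)) i<j)) bj))
  from : a < b → Less n R a b
  from a<b with <⇒topBit a b a<b
  ... | i , bi , ai , h = i , ≤-trans (<⇒≤ (bit⇒< (one bi))) b≤ , (one bi , false⇒∌ ai) , λ j _ Rij →
          (λ aj → one (trans (sym (h j (proj₁ (agree i j (inj₂ (one bi)) (inj₁ aj)) Rij))) (isOne aj))) ,
          (λ bj → one (trans (h j (proj₁ (agree i j (inj₂ (one bi)) (inj₂ bj)) Rij)) (isOne bj)))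

-- `c` codes a family of sets. If the family is a chain of initial segments, separation by a member
-- is the strict order.
Separates : ℕ → ℕ → ℕ → ℕ → Set
Separates n c a b = ∃≤ n λ I → c ∋ I × I ∋ a × ¬ (I ∋ b)

Position : ℕ → ℕ → Set
Position n a = ∃≤ n λ x → x ∋ a

-- Such `a` are at most log₂ log₂ n, and the class is closed under taking bits, so the recursion in
-- `Less` stays inside it.
Position² : ℕ → ℕ → Set
Position² n a = ∃≤ n λ p → p ∋ a × Position n p

Consistent : ℕ → ℕ → Set
Consistent n c = ∀≤ n λ a → ∀≤ n λ b → Position² n a → Position² n b → Separates n c a b ⟺ Less n (Separates n c) a b

Position²⇒≤ : ∀ {n a} → Position² n a → a ≤ n
Position²⇒≤ (p , p≤ , pa , _) = ≤-trans (<⇒≤ (bit⇒< pa)) p≤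

Position⇒≤ : ∀ {n a} → Position n a → a ≤ n
Position⇒≤ (x , x≤ , xa) = ≤-trans (<⇒≤ (bit⇒< xa)) x≤

Position²-down : ∀ {n a i} → Position² n a → a ∋ i → Position² n i
Position²-down {n} {a} (p , p≤ , pa , _) ai = a , ≤-trans (<⇒≤ (bit⇒< pa)) p≤ , ai , p , p≤ , pa

-- Bits are smaller than the number they belong to, so the fixed-point equation determines the
-- relation by induction on a bound `m` for both arguments.
Consistent-unique : ∀ n c → Consistent n c → ∀ m a b → a < m → b < m → Position² n a → Position² n b →
                    Separates n c a b ⟺ (a < b)
Consistent-unique n c con (suc m) a b (s≤s a≤m) (s≤s b≤m) Da Db =
  ⟺-trans (con a (Position²⇒≤ Da) b (Position²⇒≤ Db) Da Db)
    (Less⟺< n _ a b (Position²⇒≤ Da) (Position²⇒≤ Db) λ i j hi hj →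
      Consistent-unique n c con m i j (below hi) (below hj) (pos hi) (pos hj))
  where
  below : ∀ {i} → Bits a b i → i < m
  below (inj₁ h) = <-≤-trans (bit⇒< h) a≤m
  below (inj₂ h) = <-≤-trans (bit⇒< h) b≤m
  pos : ∀ {i} → Bits a b i → Position² n i
  pos (inj₁ h) = Position²-down Da h
  pos (inj₂ h) = Position²-down Db h

<⇒Consistent : ∀ n c → (∀ a b → Position² n a → Position² n b → Separates n c a b ⟺ (a < b)) → Consistent n c
<⇒Consistent n c sep a a≤ b b≤ Da Db = ⟺-trans (sep a b Da Db) (⟺-sym
  (Less⟺< n _ a b a≤ b≤ λ i j hi hj → sep i j (pos hi) (pos hj)))
  where
  pos : ∀ {i} → Bits a b i → Position² n i
  pos (inj₁ h) = Position²-down Da h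
  pos (inj₂ h) = Position²-down Db h

segment : ℕ → ℕ
segment k = proj₁ (comprehension k λ _ → true)

segment-bit : ∀ k i → ((segment k) ∋ i) ⟺ (i < k)
segment-bit k i with comprehension k (λ _ → true)
... | _ , _ , inside , outside = outside i , λ h → one (inside i h)

segment<2^ : ∀ k → segment k < 2 ^ k
segment<2^ k = proj₁ (proj₂ (comprehension k λ _ → true))

-- Letting `k` range below `I` is enough: `segment (suc k)` has bit `k` and therefore exceeds `k`.
isSegment : ∀ I → Fin I → Bool
isSegment I k = I ≡ᵇ segment (suc (toℕ k))

-- The order on Position² is coded by the set of its initial segments, numbers of size at most log n.
Consistent-exists : ∀ n → ∃≤ n λ c → Consistent n c
-- At n = 0 no element has a bit, so there is nothing to order; `floor-log` needs n ≥ 1.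
Consistent-exists zero = 0 , z≤n , λ a _ b _ Da _ → ⊥-elim (none Da)
  where
  none : ∀ {a} → ¬ Position² 0 a
  none (zero , _ , pa , _) = n≮0 (bit⇒< pa)
Consistent-exists n@(suc _) with floor-log 2 n ≤-refl (s≤s z≤n)
... | L , 2^L≤n , n<2^ with comprehension L (λ I → anyFin I (isSegment I))
... | c , c< , inside , outside = c , <⇒≤ (<-≤-trans c< 2^L≤n) , <⇒Consistent n c sep
  where
  -- If `b` is a bit of a position p, then 2^b ≤ p, and 2^p ≤ n gives p ≤ L. So the segments ending
  -- below `b` have codes below L and can be bits of `c`.
  2^b≤L : ∀ {b} → Position² n b → 2 ^ b ≤ L
  2^b≤L {b} (p , _ , pb , x , x≤ , xp) = ≤-trans (bit⇒2^≤ pb)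
    (≮⇒≥ λ L<p → <⇒≱ n<2^ (≤-trans (^-monoʳ-≤ 2 L<p) (≤-trans (bit⇒2^≤ xp) x≤)))
  sep : ∀ a b → Position² n a → Position² n b → Separates n c a b ⟺ (a < b)
  sep a b Da Db = to , from
    where
    to : Separates n c a b → a < b
    to (I , I≤ , cI , Ia , Ib) with proj₁ (anyFin-true I (isSegment I)) (trans (sym (inside I (outside I cI))) (isOne cI))
    ... | k , e with proj₁ (≡ᵇ-true I _) e
    ... | I≡ = ≤-trans (proj₁ (segment-bit (suc (toℕ k)) a) (subst (λ t → t ∋ a) I≡ Ia))
                (≮⇒≥ λ b< → Ib (subst (λ t → t ∋ b) (sym I≡) (proj₂ (segment-bit (suc (toℕ k)) b) b<)))
    from : a < b → Separates n c a b
    from a<b = I , ≤-trans (<⇒≤ I<L) L≤n , one (trans (inside I I<L) (proj₂ (anyFin-true I (isSegment I)) (k , hit))) ,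
        Ia , λ Ib → <⇒≱ (proj₁ (segment-bit (suc a) b) Ib) a<b
      where
      I = segment (suc a)
      Ia : I ∋ a
      Ia = proj₂ (segment-bit (suc a) a) ≤-refl
      k : Fin I
      k = fromℕ< (bit⇒< Ia)
      hit : isSegment I k ≡ true
      hit = proj₂ (≡ᵇ-true I (segment (suc (toℕ k)))) (cong (λ t → segment (suc t)) (sym (toℕ-fromℕ< (bit⇒< Ia))))
      I<L : I < L
      I<L = <-≤-trans (segment<2^ (suc a)) (≤-trans (^-monoʳ-≤ 2 a<b) (2^b≤L Db))
      L≤n : L ≤ n
      L≤n = ≤-trans (<⇒≤ (n<2^n L)) 2^L≤n

Less₂ : ℕ → ℕ → ℕ → Set
Less₂ n a b = ∃≤ n λ c → Consistent n c × Separates n c a b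

-- All consistent `c` induce the same relation, so it does not matter which one the quantifier
-- picks.
Less₂⟺< : ∀ n a b → Position² n a → Position² n b → Less₂ n a b ⟺ (a < b)
Less₂⟺< n a b Da Db =
  (λ { (c , _ , con , s) → proj₁ (unique c con) s }) ,
  (λ a<b → let (c , c≤ , con) = Consistent-exists n in c , c≤ , con , proj₂ (unique c con) a<b)
  where
  unique : ∀ c → Consistent n c → Separates n c a b ⟺ (a < b)
  unique c con = Consistent-unique n c con (suc (a + b)) a b (s≤s (m≤m+n a b)) (s≤s (m≤n+m b a)) Da Db

Less₁ : ℕ → ℕ → ℕ → Set
Less₁ n = Less n (Less₂ n)

Less₁⟺< : ∀ n a b → Position n a → Position n b → Less₁ n a b ⟺ (a < b)
Less₁⟺< n a b Pa Pb = Less⟺< n _ a b (Position⇒≤ Pa) (Position⇒≤ Pb) λ i j hi hj → Less₂⟺< n i j (pos hi) (pos hj)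
  where
  pos : ∀ {i} → Bits a b i → Position² n i
  pos (inj₁ h) = a , Position⇒≤ Pa , h , Pa
  pos (inj₂ h) = b , Position⇒≤ Pb , h , Pb

Less₀⟺< : ∀ n a b → a ≤ n → b ≤ n → Less n (Less₁ n) a b ⟺ (a < b)
Less₀⟺< n a b a≤ b≤ = Less⟺< n _ a b a≤ b≤ λ i j hi hj → Less₁⟺< n i j (pos hi) (pos hj)
  where
  pos : ∀ {i} → Bits a b i → Position n i
  pos (inj₁ h) = a , a≤ , h
  pos (inj₂ h) = b , b≤ , h

module _ {σ : Vocab} {n₀ : ℕ} where

  Lessᵈ : {R : ℕ → ℕ → ℕ → ℕ → Set} → (∀ {m} (z x y : Fin m) → Def σ n₀ m (λ n e → R n (e z) (e x) (e y))) →
          ∀ {m} (z x y : Fin m) → Def σ n₀ m (λ n e → Less n (R n (e z)) (e x) (e y))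
  Lessᵈ R z x y = ∃ᵈ ((bitᵈ (fs y) v₀ ×ᵈ ¬ᵈ (bitᵈ (fs x) v₀)) ×ᵈ
    ∀ᵈ (R (↑² z) v₁ v₀ →ᵈ (bitᵈ (↑² x) v₀ ⟺ᵈ bitᵈ (↑² y) v₀)))

  Separatesᵈ : ∀ {m} (z x y : Fin m) → Def σ n₀ m (λ n e → Separates n (e z) (e x) (e y))
  Separatesᵈ z x y = ∃ᵈ (bitᵈ (fs z) v₀ ×ᵈ bitᵈ v₀ (fs x) ×ᵈ ¬ᵈ (bitᵈ v₀ (fs y)))

  Position²ᵈ : ∀ {m} (x : Fin m) → Def σ n₀ m (λ n e → Position² n (e x))
  Position²ᵈ x = ∃ᵈ (bitᵈ v₀ (fs x) ×ᵈ ∃ᵈ (bitᵈ v₀ v₁))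

  Consistentᵈ : ∀ {m} (z : Fin m) → Def σ n₀ m (λ n e → Consistent n (e z))
  Consistentᵈ z = ∀ᵈ (∀ᵈ (Position²ᵈ v₁ →ᵈ Position²ᵈ v₀ →ᵈ
    (Separatesᵈ (↑² z) v₁ v₀ ⟺ᵈ Lessᵈ {Separates} Separatesᵈ (↑² z) v₁ v₀)))

  Less₂ᵈ : ∀ {m} (x y : Fin m) → Def σ n₀ m (λ n e → Less₂ n (e x) (e y))
  Less₂ᵈ x y = ∃ᵈ (Consistentᵈ v₀ ×ᵈ Separatesᵈ v₀ (fs x) (fs y))

  infix 7 _<ᵈ_
  _<ᵈ_ : ∀ {m} (x y : Fin m) → Def σ n₀ m (λ n e → e x < e y)
  x <ᵈ y = respᵈ (λ n e _ bnd → Less₀⟺< n (e x) (e y) (bnd x) (bnd y))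
    (Lessᵈ {λ n _ → Less₁ n} (λ _ x y → Lessᵈ {λ n _ → Less₂ n} (λ _ → Less₂ᵈ) x x y) x x y)

-- Addition

bin : (ℕ → ℕ) → ℕ → ℕ
bin f zero    = 0
bin f (suc m) = bin f m + f m * 2 ^ m

bin-cong : ∀ m {f g : ℕ → ℕ} → (∀ i → i < m → f i ≡ g i) → bin f m ≡ bin g m
bin-cong zero    h = refl
bin-cong (suc m) h = cong₂ (λ s t → s + t * 2 ^ m) (bin-cong m λ i i< → h i (m≤n⇒m≤1+n i<)) (h m ≤-refl)

bin-cons : ∀ m f → bin f (suc m) ≡ f 0 + 2 * bin (f ∘ suc) m
bin-cons zero    f = lemma (f 0)
  where
  lemma : ∀ x → 0 + x * 1 ≡ x + 2 * 0
  lemma = solve-∀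
bin-cons (suc m) f = trans (cong (_+ f (suc m) * 2 ^ suc m) (bin-cons m f)) (lemma (f 0) (bin (f ∘ suc) m) (f (suc m)) (2 ^ m))
  where
  lemma : ∀ x b y p → x + 2 * b + y * (2 * p) ≡ x + 2 * (b + y * p)
  lemma = solve-∀

bin-+ : ∀ m f g → bin (λ i → f i + g i) m ≡ bin f m + bin g m
bin-+ zero    f g = refl
bin-+ (suc m) f g = trans (cong (_+ (f m + g m) * 2 ^ m) (bin-+ m f g)) (lemma (bin f m) (bin g m) (f m) (g m) (2 ^ m))
  where
  lemma : ∀ a b x y p → a + b + (x + y) * p ≡ a + x * p + (b + y * p)
  lemma = solve-∀

bin-*ˡ : ∀ m k f → bin (λ i → k * f i) m ≡ k * bin f m
bin-*ˡ zero    k f = sym (*-zeroʳ k)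
bin-*ˡ (suc m) k f = trans (cong (_+ k * f m * 2 ^ m) (bin-*ˡ m k f)) (lemma k (bin f m) (f m) (2 ^ m))
  where
  lemma : ∀ k a x p → k * a + k * x * p ≡ k * (a + x * p)
  lemma = solve-∀

bin-dig : ∀ m a → a < 2 ^ m → bin (dig a) m ≡ a
bin-dig zero    zero _ = refl
bin-dig zero    (suc a) (s≤s ())
bin-dig (suc m) a a< = begin
  bin (dig a) (suc m)                  ≡⟨ bin-cons m (dig a) ⟩
  dig a 0 + 2 * bin (dig a ∘ suc) m    ≡⟨ cong (λ t → dig a 0 + 2 * t) (bin-cong m λ i _ → cong b2n (bit-suc a i)) ⟩
  dig a 0 + 2 * bin (dig (a / 2)) m    ≡⟨ cong (λ t → dig a 0 + 2 * t) (bin-dig m (a / 2) (<2^suc⇒half a m a<)) ⟩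
  dig a 0 + 2 * (a / 2)                ≡⟨ half-split a ⟨
  a                                    ∎
  where open ≡-Reasoning

carry-next : ∀ a b p c d z c′ → a ≡ b + p * c → c + d ≡ z + 2 * c′ → a + d * p ≡ b + z * p + 2 * p * c′
carry-next a b p c d z c′ e e′ = begin
  a + d * p                   ≡⟨ cong (_+ d * p) e ⟩
  b + p * c + d * p           ≡⟨ lemma₁ b p c d ⟩
  b + p * (c + d)             ≡⟨ cong (λ t → b + p * t) e′ ⟩
  b + p * (z + 2 * c′)        ≡⟨ lemma₂ b p z c′ ⟩
  b + z * p + 2 * p * c′      ∎
  where
  open ≡-Reasoning
  lemma₁ : ∀ b p c d → b + p * c + d * p ≡ b + p * (c + d)
  lemma₁ = solve-∀
  lemma₂ : ∀ b p z c → b + p * (z + 2 * c) ≡ b + z * p + 2 * p * c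
  lemma₂ = solve-∀

-- Telescoping, with `C k` of weight 2^k. The digits `d` are arbitrary numbers, so the identity
-- serves both sums of two bits and column sums of a product.
carry-chain : ∀ m (C d z : ℕ → ℕ) → (∀ k → k < m → C k + d k ≡ z k + 2 * C (suc k)) →
              C 0 + bin d m ≡ bin z m + 2 ^ m * C m
carry-chain zero    C d z h = trans (+-identityʳ (C 0)) (sym (*-identityˡ (C 0)))
carry-chain (suc m) C d z h = trans (sym (+-assoc (C 0) (bin d m) _))
  (carry-next _ (bin z m) (2 ^ m) (C m) (d m) (z m) (C (suc m)) (carry-chain m C d z λ k k< → h k (m≤n⇒m≤1+n k<)) (h m ≤-refl))

module Carries (d : ℕ → ℕ) where

  carry : ℕ → ℕ
  carry zero    = 0
  carry (suc k) = (carry k + d k) / 2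

  out : ℕ → Bool
  out k = ((carry k + d k) % 2) ≡ᵇ 1

  carry-step : ∀ k → carry k + d k ≡ b2n (out k) + 2 * carry (suc k)
  carry-step k = trans (m≡m%n+[m/n]*n (carry k + d k) 2)
    (cong₂ _+_ (%2-bit _ (m%n<n (carry k + d k) 2)) (*-comm ((carry k + d k) / 2) 2))

  -- The chain gives `a ≡ a′ + 2 ^ m * carry m`, so `a < 2 ^ m` leaves no room for a last carry and
  -- the outputs are the bits of `a`.
  carry-result : ∀ m a → a < 2 ^ m → bin d m ≡ a → carry m ≡ 0 × (∀ k → k < m → bitᵇ a k ≡ out k)
  carry-result m a a< e with comprehension m out
  ... | a′ , a′< , bits , _ = carry≡0 , λ k k< → trans (cong (λ t → bitᵇ t k) a≡a′) (bits k k<)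
    where
    chain : a ≡ a′ + 2 ^ m * carry m
    chain = begin
      a                                   ≡⟨ e ⟨
      bin d m                             ≡⟨ carry-chain m carry d (b2n ∘ out) (λ k _ → carry-step k) ⟩
      bin (b2n ∘ out) m + 2 ^ m * carry m ≡⟨ cong (_+ 2 ^ m * carry m) (trans (bin-cong m λ i i< → cong b2n (sym (bits i i<))) (bin-dig m a′ a′<)) ⟩
      a′ + 2 ^ m * carry m                ∎
      where open ≡-Reasoning
    carry≡0 : carry m ≡ 0
    carry≡0 with carry m in c
    ... | zero  = refl
    ... | suc j = ⊥-elim (<⇒≱ a< (begin
      2 ^ m               ≤⟨ m≤m*n (2 ^ m) (suc j) ⟩
      2 ^ m * suc j       ≡⟨ cong (2 ^ m *_) c ⟨
      2 ^ m * carry m     ≤⟨ m≤n+m _ a′ ⟩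
      a′ + 2 ^ m * carry m ≡⟨ chain ⟨
      a                   ∎))
      where open ≤-Reasoning
    a≡a′ : a ≡ a′
    a≡a′ = trans chain (trans (cong (λ t → a′ + 2 ^ m * t) carry≡0) (trans (cong (a′ +_) (*-zeroʳ (2 ^ m))) (+-identityʳ a′)))

shiftIn : ℕ → ℕ → Bool
shiftIn v zero    = false
shiftIn v (suc i) = bitᵇ v i

-- v collects the carries out of each position.
Adder : ℕ → ℕ → ℕ → ℕ → ℕ → Set
Adder x y z v i = b2n (shiftIn v i) + (b2n (bitᵇ x i) + b2n (bitᵇ y i)) ≡ b2n (bitᵇ z i) + 2 * b2n (bitᵇ v i)

Sum : ℕ → ℕ → ℕ → ℕ → Set
Sum n x y z = ∃≤ n λ v → ∀≤ n λ i → Adder x y z v i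

n<2^1+n : ∀ {m n} → m ≤ n → m < 2 ^ suc n
n<2^1+n {m} {n} m≤n = <-≤-trans (n<2^n m) (^-monoʳ-≤ 2 (m≤n⇒m≤1+n m≤n))

-- The local rule telescopes to the sum; conversely the true carries obey it. They fit into one
-- element because no carry leaves a position from L on.
Sum⟺+ : ∀ n x y z → 1 ≤ n → x ≤ n → y ≤ n → z ≤ n → Sum n x y z ⟺ (x + y ≡ z)
Sum⟺+ n x y z 1≤n x≤ y≤ z≤ = to , from
  where
  to : Sum n x y z → x + y ≡ z
  to (v , v≤ , h) = begin
    x + y                                       ≡⟨ cong₂ _+_ (bin-dig (suc n) x (n<2^1+n x≤)) (bin-dig (suc n) y (n<2^1+n y≤)) ⟨
    bin (dig x) (suc n) + bin (dig y) (suc n)   ≡⟨ bin-+ (suc n) (dig x) (dig y) ⟨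
    bin (λ i → dig x i + dig y i) (suc n)       ≡⟨ carry-chain (suc n) (λ i → b2n (shiftIn v i)) (λ i → dig x i + dig y i) (dig z) (λ k k< → h k (<⇒≤pred k<)) ⟩
    -- The rule is imposed at positions 0 to n only; the carry out of position n vanishes because
    -- `v ≤ n < 2 ^ n`.
    bin (dig z) (suc n) + 2 ^ suc n * dig v n   ≡⟨ cong₂ (λ s t → s + 2 ^ suc n * b2n t) (bin-dig (suc n) z (n<2^1+n z≤)) (bit-high v n (≤-<-trans v≤ (n<2^n n))) ⟩
    z + 2 ^ suc n * 0                           ≡⟨ trans (cong (z +_) (*-zeroʳ (2 ^ suc n))) (+-identityʳ z) ⟩
    z                                           ∎
    where open ≡-Reasoning
  from : x + y ≡ z → Sum n x y z
  from e with floor-log 2 n ≤-refl 1≤n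
  ... | L , 2^L≤n , n< with comprehension L (λ i → Carries.carry (λ i → dig x i + dig y i) (suc i) ≡ᵇ 1)
  ... | v , v< , inside , outside = v , <⇒≤ (<-≤-trans v< 2^L≤n) , adder
    where
    open Carries (λ i → dig x i + dig y i)
    carry≤1 : ∀ k → carry k < 2
    carry≤1 zero    = s≤s z≤n
    carry≤1 (suc k) = m<n*o⇒m/o<n (≤-<-trans (+-mono-≤ (<⇒≤pred (carry≤1 k)) (+-mono-≤ (b2n≤1 (bitᵇ x k)) (b2n≤1 (bitᵇ y k)))) ≤-refl)
    settle : ∀ m → z < 2 ^ m → carry m ≡ 0 × (∀ k → k < m → bitᵇ z k ≡ out k)
    settle m z< = carry-result m z z< (trans (bin-+ m (dig x) (dig y))
      (trans (cong₂ _+_ (bin-dig m x (≤-<-trans (m+n≤o⇒m≤o x (≤-reflexive e)) z<)) (bin-dig m y (≤-<-trans (m+n≤o⇒n≤o x (≤-reflexive e)) z<))) e))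
    v-carry : ∀ i → b2n (bitᵇ v i) ≡ carry (suc i)
    v-carry i with i <? L
    ... | yes i<L = trans (cong b2n (inside i i<L)) (sym (%2-bit _ (carry≤1 (suc i))))
    ... | no i≮L  = trans (cong b2n (∌⇒false {v} {i} λ h → i≮L (outside i h)))
                          (sym (proj₁ (settle (suc i) (<-≤-trans (≤-<-trans z≤ n<) (^-monoʳ-≤ 2 (s≤s (≮⇒≥ i≮L)))))))
    shift-carry : ∀ i → b2n (shiftIn v i) ≡ carry i
    shift-carry zero    = refl
    shift-carry (suc i) = v-carry i
    adder : ∀≤ n λ i → Adder x y z v i
    adder i i≤ = begin
      b2n (shiftIn v i) + (dig x i + dig y i)   ≡⟨ cong (_+ (dig x i + dig y i)) (shift-carry i) ⟩
      carry i + (dig x i + dig y i)             ≡⟨ carry-step i ⟩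
      b2n (out i) + 2 * carry (suc i)           ≡⟨ cong₂ (λ s t → b2n s + 2 * t) (proj₂ (settle (suc n) (n<2^1+n z≤)) i (s≤s i≤)) (v-carry i) ⟨
      dig z i + 2 * b2n (bitᵇ v i)              ∎
      where open ≡-Reasoning

module _ {σ : Vocab} {n₀ m : ℕ} where

  bitᵇᵈ : (x y : Fin m) → Def σ n₀ m (λ n e → bitᵇ (e x) (e y) ≡ true)
  bitᵇᵈ x y = respᵈ (λ _ _ _ _ → isOne , one) (bitᵈ x y)

  -- After splitting on a definable Boolean, arithmetic on bits turns into closed statements or into
  -- plain equality and successor conditions.
  caseᵈ : {F : Bool → Pred m} {g : ℕ → (Fin m → ℕ) → Bool} →
          Def σ n₀ m (λ n e → g n e ≡ true) → (∀ b → Def σ n₀ m (F b)) → Def σ n₀ m (λ n e → F (g n e) n e)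
  caseᵈ {F} {g} b f = respᵈ (λ n e _ _ → lemma {λ b → F b n e} (g n e)) ((b ×ᵈ f true) ⊎ᵈ (¬ᵈ b ×ᵈ f false))
    where
    lemma : ∀ {F : Bool → Set} b → ((b ≡ true × F true) ⊎ (¬ (b ≡ true) × F false)) ⟺ F b
    lemma true  = (λ { (inj₁ (_ , x)) → x ; (inj₂ (h , _)) → ⊥-elim (h refl) }) , λ x → inj₁ (refl , x)
    lemma false = (λ { (inj₁ (() , _)) ; (inj₂ (_ , x)) → x }) , λ x → inj₂ ((λ ()) , x)

  zeroᵈ : (x : Fin m) → Def σ n₀ m (λ n e → e x ≡ 0)
  zeroᵈ x = respᵈ (λ n e _ bnd → (λ h → n≤0⇒n≡0 (≮⇒≥ (h 0 z≤n))) , λ { p a _ a< → n≮0 (subst (a <_) p a<) })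
    (∀ᵈ (¬ᵈ (v₀ <ᵈ fs x)))

  sucᵈ : (x y : Fin m) → Def σ n₀ m (λ n e → suc (e x) ≡ e y)
  sucᵈ x y = respᵈ (λ n e _ bnd →
      (λ { (x<y , h) → ≤-antisym x<y (≮⇒≥ λ lt → h (suc (e x)) (≤-trans x<y (bnd y)) (n<1+n _ , lt)) }) ,
      (λ p → ≤-reflexive p , λ { a _ (x<a , a<y) → <⇒≱ a<y (≤-trans (≤-reflexive (sym p)) x<a) }))
    (x <ᵈ y ×ᵈ ∀ᵈ (¬ᵈ (fs x <ᵈ v₀ ×ᵈ v₀ <ᵈ fs y)))

module _ {σ : Vocab} {n₀ : ℕ} where

  shiftInᵈ : ∀ {m} (v i : Fin m) → Def σ n₀ m (λ n e → shiftIn (e v) (e i) ≡ true)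
  shiftInᵈ v i = respᵈ (λ n e _ bnd → lemma n (e v) (e i) (bnd i)) (∃ᵈ (sucᵈ v₀ (fs i) ×ᵈ bitᵈ (fs v) v₀))
    where
    lemma : ∀ n v i → i ≤ n → (∃≤ n λ j → suc j ≡ i × v ∋ j) ⟺ (shiftIn v i ≡ true)
    lemma n v zero    _  = (λ { (_ , _ , () , _) }) , λ ()
    lemma n v (suc i) i≤ = (λ { (j , _ , refl , h) → isOne h }) , λ h → i , ≤-trans (n≤1+n i) i≤ , refl , one h

  Adderᵈ : ∀ {m} (x y z v i : Fin m) → Def σ n₀ m (λ n e → Adder (e x) (e y) (e z) (e v) (e i))
  Adderᵈ x y z v i =
    caseᵈ {g = λ n e → shiftIn (e v) (e i)} (shiftInᵈ v i) λ b₀ → caseᵈ {g = λ n e → bitᵇ (e x) (e i)} (bitᵇᵈ x i) λ b₁ →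
    caseᵈ {g = λ n e → bitᵇ (e y) (e i)} (bitᵇᵈ y i) λ b₂ → caseᵈ {g = λ n e → bitᵇ (e z) (e i)} (bitᵇᵈ z i) λ b₃ →
    caseᵈ {F = λ b₄ _ _ → b2n b₀ + (b2n b₁ + b2n b₂) ≡ b2n b₃ + 2 * b2n b₄} {g = λ n e → bitᵇ (e v) (e i)} (bitᵇᵈ v i) λ b₄ →
    constᵈ (b2n b₀ + (b2n b₁ + b2n b₂) ≟ b2n b₃ + 2 * b2n b₄)

  sumᵈ : 1 ≤ n₀ → ∀ {m} (x y z : Fin m) → Def σ n₀ m (λ n e → e x + e y ≡ e z)
  sumᵈ 1≤n₀ x y z = respᵈ (λ n e n₀≤ bnd → Sum⟺+ n (e x) (e y) (e z) (≤-trans 1≤n₀ n₀≤) (bnd x) (bnd y) (bnd z))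
    (∃ᵈ (∀ᵈ (Adderᵈ (↑² x) (↑² y) (↑² z) v₁ v₀)))

-- Long paths coded by elements

-- Every n above a threshold is Large: L = ⌊log₂ n⌋, and 2^h + 1 blocks of 2h bits, each able to hold
-- a number up to L + 1, fit into L bits, while a two-level path of blocks has (2^h)² > L + 1 steps.
record Large (n : ℕ) : Set where
  field
    L h     : ℕ
    2^L≤n   : 2 ^ L ≤ n
    n<2^1+L : n < 2 ^ suc L
    small   : suc L < 2 ^ (2 * h)
    fits    : 2 * h * suc (2 ^ h) ≤ L
    1≤h     : 1 ≤ h
    room    : suc L + suc L ≤ n

State : Set
State = ℕ × ℕ

Below : ℕ → State → Set
Below b (x , y) = x < b × y < b

-- The address `p + i` is named by an element `j`, since addition is available only as a relation on
-- [n]; addresses beyond n read as 0.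
Field : ℕ → ℕ → ℕ → ℕ → ℕ → Set
Field n z w p u = ∀≤ n λ i → (u ∋ i) ⟺ (i < w × ∃≤ n λ j → p + i ≡ j × z ∋ j)

Stored : ℕ → ℕ → ℕ → ℕ → ℕ → State → Set
Stored n z₁ z₂ w p (x , y) = Field n z₁ w p x × Field n z₂ w p y

Step : ℕ → (State → State → Set) → ℕ → ℕ → ℕ → ℕ → ℕ → Set
-- `p < p′` rules out width 0 and makes every walk along the marks end.
Step n R w M z₁ z₂ p = ∃≤ n λ p′ → p + w ≡ p′ × p < p′ × M ∋ p′ ×
  ∃≤ n λ a → ∃≤ n λ b → ∃≤ n λ c → ∃≤ n λ d →
  Stored n z₁ z₂ w p (a , b) × Stored n z₁ z₂ w p′ (c , d) × R (a , b) (c , d)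

-- An R-path from s to t whose states are written one after the other, in fields of w bits, into z₁ and z₂.
-- M is the set of the starting positions of the fields.
Leap : ℕ → (State → State → Set) → State → State → Set
Leap n R s t = ∃≤ n λ w → ∃≤ n λ M → ∃≤ n λ z₁ → ∃≤ n λ z₂ → ∃≤ n λ p → ∃≤ n λ q →
  M ∋ p × Stored n z₁ z₂ w p s × Stored n z₁ z₂ w q t ×
  ∀≤ n λ x → M ∋ x → ¬ (x ≡ q) → Step n R w M z₁ z₂ x

Field-unique : ∀ {n z w p u u′} → u ≤ n → u′ ≤ n → Field n z w p u → Field n z w p u′ → u ≡ u′
Field-unique {u = u} {u′} u≤ u′≤ h h′ = bit-ext u u′ λ i → ∋-ext u i u′ i
  (λ m → proj₂ (h′ i (≤-trans (<⇒≤ (bit⇒< m)) u≤)) (proj₁ (h i (≤-trans (<⇒≤ (bit⇒< m)) u≤)) m))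
  (λ m → proj₂ (h i (≤-trans (<⇒≤ (bit⇒< m)) u′≤)) (proj₁ (h′ i (≤-trans (<⇒≤ (bit⇒< m)) u′≤)) m))

Stored-unique : ∀ {n z₁ z₂ w p s t} → Below (suc n) s → Below (suc n) t →
                Stored n z₁ z₂ w p s → Stored n z₁ z₂ w p t → s ≡ t
Stored-unique {n} (s≤s a , s≤s b) (s≤s c , s≤s d) (h₁ , h₂) (h₁′ , h₂′) =
  cong₂ _,_ (Field-unique {n} a c h₁ h₁′) (Field-unique {n} b d h₂ h₂′)

Preserves : ℕ → (State → Set) → (State → State → Set) → Set
Preserves n Inv R = ∀ s t → Below (suc n) s → Below (suc n) t → Inv s → R s t → Inv t

-- Soundness is phrased through invariants, so it can be iterated with `Leap n R` in the role of
-- `R`. Each step raises the position, so a walk that missed `q` would leave [n].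
Leap-preserves : ∀ n R Inv → Preserves n Inv R → Preserves n Inv (Leap n R)
Leap-preserves n R Inv pres s t s< t< inv-s (w , _ , M , _ , z₁ , _ , z₂ , _ , p , p≤ , q , q≤ , Mp , at-p , at-q , step) =
  walk (suc n) p s (m≤n+m (suc n) p) p≤ Mp s< at-p inv-s
  where
  walk : ∀ fuel x s → suc n ≤ x + fuel → x ≤ n → M ∋ x → Below (suc n) s → Stored n z₁ z₂ w x s → Inv s → Inv t
  walk zero x s far x≤ _ _ _ _ = ⊥-elim (<⇒≱ far (subst (_≤ n) (sym (+-identityʳ x)) x≤))
  walk (suc fuel) x s far x≤ Mx s< at-x inv with x ≟ q
  ... | yes refl = subst Inv (Stored-unique {n} s< t< at-x at-q) inv
  ... | no x≢q with step x x≤ Mx x≢q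
  ... | y , y≤ , _ , x<y , My , a , a≤ , b , b≤ , c , c≤ , d , d≤ , at-x′ , at-y , Rst =
    walk fuel y (c , d) (≤-trans far (≤-trans (≤-reflexive (+-suc x fuel)) (+-monoˡ-≤ fuel x<y))) y≤ My (s≤s c≤ , s≤s d≤) at-y
      -- The step guesses its own source state; since fields are read uniquely, it is the current
      -- one.
      (pres (a , b) (c , d) (s≤s a≤ , s≤s b≤) (s≤s c≤ , s≤s d≤)
        (subst Inv (Stored-unique {n} s< (s≤s a≤ , s≤s b≤) at-x at-x′) inv) Rst)

div-field : ∀ t w i .{{_ : NonZero w}} → i < w → (t * w + i) / w ≡ t
div-field t w i i<w = trans (+-distrib-/-∣ˡ i (n∣m*n t)) (trans (cong₂ _+_ (m*n/n≡m t w) (m<n⇒m/n≡0 i<w)) (+-identityʳ t))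

mod-field : ∀ t w i .{{_ : NonZero w}} → i < w → (t * w + i) % w ≡ i
mod-field t w i i<w = trans (cong (_% w) (+-comm (t * w) i)) (trans ([m+kn]%n≡m%n i t w) (m<n⇒m%n≡m i<w))

-- A path of `B` steps has `suc B` states, hence the factor in `fits`.
module Record (n L w B : ℕ) .{{_ : NonZero w}} (2^L≤n : 2 ^ L ≤ n) (fits : w * suc B ≤ L) where

  L≤n : L ≤ n
  L≤n = ≤-trans (<⇒≤ (n<2^n L)) 2^L≤n

  w≤L : w ≤ L
  w≤L = ≤-trans (m≤m*n w (suc B)) fits

  field-inside : ∀ {t i} → t ≤ B → i < w → t * w + i < L
  field-inside {t} {i} t≤B i<w = begin-strict
    t * w + i   <⟨ +-monoʳ-< (t * w) i<w ⟩
    t * w + w   ≡⟨ +-comm (t * w) w ⟩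
    suc t * w   ≡⟨ *-comm (suc t) w ⟩
    w * suc t   ≤⟨ *-monoʳ-≤ w (s≤s t≤B) ⟩
    w * suc B   ≤⟨ fits ⟩
    L           ∎
    where open ≤-Reasoning

  start<L : ∀ {t} → t ≤ B → t * w < L
  start<L {t} t≤B = subst (_< L) (+-identityʳ (t * w)) (field-inside {t} {0} t≤B (n≢0⇒n>0 (≢-nonZero⁻¹ w)))

  tape : ∀ (u : ℕ → ℕ) b → b ≤ B → (∀ t → t ≤ b → u t < 2 ^ w) →
         ∃≤ n λ z → ∀ t → t ≤ b → Field n z w (t * w) (u t)
  -- Position `t * w + i` holds bit `i` of field `t`; division with remainder recovers both indices.
  tape u b b≤B u< with comprehension L (λ j → bitᵇ (u (j / w)) (j % w))
  ... | z , z< , inside , _ = z , <⇒≤ (<-≤-trans z< 2^L≤n) , λ t t≤b i i≤ → to t t≤b i , from t t≤b i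
    where
    read : ∀ t → t ≤ b → ∀ i → i < w → bitᵇ z (t * w + i) ≡ bitᵇ (u t) i
    read t t≤b i i<w = trans (inside (t * w + i) (field-inside (≤-trans t≤b b≤B) i<w))
      (cong₂ (λ x y → bitᵇ (u x) y) (div-field t w i i<w) (mod-field t w i i<w))
    to : ∀ t → t ≤ b → ∀ i → u t ∋ i → i < w × ∃≤ n λ j → t * w + i ≡ j × z ∋ j
    to t t≤b i m = i<w , t * w + i , ≤-trans (<⇒≤ (field-inside (≤-trans t≤b b≤B) i<w)) L≤n , refl ,
                   one (trans (read t t≤b i i<w) (isOne m))
      where
      i<w : i < w
      i<w = ≰⇒> λ w≤i → <⇒≱ (u< t t≤b) (≤-trans (^-monoʳ-≤ 2 w≤i) (bit⇒2^≤ m))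
    from : ∀ t → t ≤ b → ∀ i → (i < w × ∃≤ n λ j → t * w + i ≡ j × z ∋ j) → u t ∋ i
    from t t≤b i (i<w , _ , _ , refl , m) = one (trans (sym (read t t≤b i i<w)) (isOne m))

  Leap-complete : ∀ R (f : ℕ → State) b → b ≤ B → (∀ t → t < b → R (f t) (f (suc t))) →
                  (∀ t → t ≤ b → Below (2 ^ w) (f t)) → Leap n R (f 0) (f b)
  Leap-complete R f b b≤B steps f<
    with comprehension L (λ x → anyFin (suc b) λ k → x ≡ᵇ toℕ k * w)
       | tape (proj₁ ∘ f) b b≤B (λ t t≤ → proj₁ (f< t t≤)) | tape (proj₂ ∘ f) b b≤B (λ t t≤ → proj₂ (f< t t≤))
  ... | M , M< , inside , outside | z₁ , z₁≤ , field₁ | z₂ , z₂≤ , field₂ =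
    w , ≤-trans w≤L L≤n , M , <⇒≤ (<-≤-trans M< 2^L≤n) , z₁ , z₁≤ , z₂ , z₂≤ , 0 , z≤n ,
    b * w , start≤n ≤-refl , mark 0 z≤n , stored 0 z≤n , stored b ≤-refl , step
    where
    start≤n : ∀ {t} → t ≤ b → t * w ≤ n
    start≤n t≤b = ≤-trans (<⇒≤ (start<L (≤-trans t≤b b≤B))) L≤n
    stored : ∀ t → t ≤ b → Stored n z₁ z₂ w (t * w) (f t)
    stored t t≤b = field₁ t t≤b , field₂ t t≤b
    mark : ∀ t → t ≤ b → M ∋ t * w
    mark t t≤b = one (trans (inside (t * w) (start<L (≤-trans t≤b b≤B)))
      (proj₂ (anyFin-true (suc b) (λ k → t * w ≡ᵇ toℕ k * w))
        (fromℕ< (s≤s t≤b) , proj₂ (≡ᵇ-true _ _) (cong (_* w) (sym (toℕ-fromℕ< (s≤s t≤b)))))))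
    marked : ∀ x → M ∋ x → ∃ λ t → t ≤ b × x ≡ t * w
    marked x m with proj₁ (anyFin-true (suc b) (λ k → x ≡ᵇ toℕ k * w)) (trans (sym (inside x (outside x m))) (isOne m))
    ... | k , e = toℕ k , <⇒≤pred (toℕ<n k) , proj₁ (≡ᵇ-true _ _) e
    bound : ∀ {x} → x < 2 ^ w → x ≤ n
    bound x< = ≤-trans (<⇒≤ x<) (≤-trans (^-monoʳ-≤ 2 w≤L) 2^L≤n)
    step : ∀≤ n λ x → M ∋ x → ¬ (x ≡ b * w) → Step n R w M z₁ z₂ x
    step x x≤ m x≢ with marked x m
    ... | t , t≤b , refl = suc t * w , start≤n t<b , +-comm (t * w) w , *-monoˡ-< w (n<1+n t) , mark (suc t) t<b ,
      _ , bound (proj₁ (f< t t≤b)) , _ , bound (proj₂ (f< t t≤b)) ,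
      _ , bound (proj₁ (f< (suc t) t<b)) , _ , bound (proj₂ (f< (suc t) t<b)) ,
      stored t t≤b , stored (suc t) t<b , steps t t<b
      where
      t<b : t < b
      t<b = ≤∧≢⇒< t≤b λ t≡b → x≢ (cong (_* w) t≡b)

  -- The path is cut at the multiples of `B`, capped at `K`. Each of the `B` chunks has at most `B`
  -- steps, the last ones possibly none, and is a single step of the outer path.
  Leap²-complete : ∀ R (f : ℕ → State) K → K ≤ B * B → (∀ t → t < K → R (f t) (f (suc t))) →
                   (∀ t → t ≤ K → Below (2 ^ w) (f t)) → Leap n (Leap n R) (f 0) (f K)
  Leap²-complete R f K K≤ steps f< = subst (Leap n (Leap n R) (f 0)) (cong f (m≥n⇒m⊓n≡n K≤))
    (Leap-complete (Leap n R) (λ t → f (t * B ⊓ K)) B ≤-refl (λ t _ → chunk t) (λ t _ → f< (t * B ⊓ K) (m⊓n≤n (t * B) K)))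
    where
    chunk : ∀ t → Leap n R (f (t * B ⊓ K)) (f (suc t * B ⊓ K))
    chunk t = subst₂ (λ x y → Leap n R (f x) (f y)) (+-identityʳ o) o+b (Leap-complete R (λ i → f (o + i)) b b≤B
        (λ i i<b → subst (λ x → R (f (o + i)) (f x)) (sym (+-suc o i)) (steps (o + i) (<-≤-trans (+-monoʳ-< o i<b) o+b≤K)))
        (λ i i≤b → f< (o + i) (≤-trans (+-monoʳ-≤ o i≤b) o+b≤K)))
      where
      o = t * B ⊓ K
      b = (suc t * B ⊓ K) ∸ o
      o+b : o + b ≡ suc t * B ⊓ K
      o+b = m+[n∸m]≡n (⊓-monoˡ-≤ K (m≤n+m (t * B) B))
      o+b≤K : o + b ≤ K
      o+b≤K = ≤-trans (≤-reflexive o+b) (m⊓n≤n (suc t * B) K)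
      b≤B : b ≤ B
      b≤B = m≤n+o⇒m∸n≤o (suc t * B ⊓ K) o (begin
        suc t * B ⊓ K             ≤⟨ ⊓-monoʳ-≤ (suc t * B) (m≤n+m K B) ⟩
        (B + t * B) ⊓ (B + K)     ≡⟨ +-distribˡ-⊓ B (t * B) K ⟨
        B + (t * B ⊓ K)           ≡⟨ +-comm B o ⟩
        o + B                     ∎)
        where open ≤-Reasoning

DefRel : Vocab → ℕ → (ℕ → ℕ → ℕ → ℕ → State → State → Set) → Set
DefRel σ n₀ R = ∀ {m} (x y z a b c d : Fin m) →
                Def σ n₀ m (λ n e → R n (e x) (e y) (e z) (e a , e b) (e c , e d))

module _ {σ : Vocab} {n₀ : ℕ} (1≤n₀ : 1 ≤ n₀) where

  Fieldᵈ : ∀ {m} (z w p u : Fin m) → Def σ n₀ m (λ n e → Field n (e z) (e w) (e p) (e u))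
  Fieldᵈ z w p u = ∀ᵈ (bitᵈ (fs u) v₀ ⟺ᵈ (v₀ <ᵈ fs w ×ᵈ ∃ᵈ (sumᵈ 1≤n₀ (↑² p) v₁ v₀ ×ᵈ bitᵈ (↑² z) v₀)))

  Storedᵈ : ∀ {m} (z₁ z₂ w p a b : Fin m) → Def σ n₀ m (λ n e → Stored n (e z₁) (e z₂) (e w) (e p) (e a , e b))
  Storedᵈ z₁ z₂ w p a b = Fieldᵈ z₁ w p a ×ᵈ Fieldᵈ z₂ w p b

  Stepᵈ : ∀ {R} → DefRel σ n₀ R → ∀ {m} (x y z w M z₁ z₂ p : Fin m) →
          Def σ n₀ m (λ n e → Step n (R n (e x) (e y) (e z)) (e w) (e M) (e z₁) (e z₂) (e p))
  Stepᵈ R x y z w M z₁ z₂ p = ∃ᵈ (sumᵈ 1≤n₀ (fs p) (fs w) v₀ ×ᵈ fs p <ᵈ v₀ ×ᵈ bitᵈ (fs M) v₀ ×ᵈ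
    ∃ᵈ (∃ᵈ (∃ᵈ (∃ᵈ (Storedᵈ (fs (↑⁴ z₁)) (fs (↑⁴ z₂)) (fs (↑⁴ w)) (fs (↑⁴ p)) v₃ v₂ ×ᵈ
      Storedᵈ (fs (↑⁴ z₁)) (fs (↑⁴ z₂)) (fs (↑⁴ w)) v₄ v₁ v₀ ×ᵈ R (fs (↑⁴ x)) (fs (↑⁴ y)) (fs (↑⁴ z)) v₃ v₂ v₁ v₀)))))

  Leapᵈ : ∀ {R} → DefRel σ n₀ R → DefRel σ n₀ (λ n x y z → Leap n (R n x y z))
  Leapᵈ {R} Rᵈ x y z a b c d = ∃ᵈ (∃ᵈ (∃ᵈ (∃ᵈ (∃ᵈ (∃ᵈ (bitᵈ v₄ v₁ ×ᵈ
    Storedᵈ v₃ v₂ v₅ v₁ (↑⁶ a) (↑⁶ b) ×ᵈ Storedᵈ v₃ v₂ v₅ v₀ (↑⁶ c) (↑⁶ d) ×ᵈ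
    ∀ᵈ (bitᵈ v₅ v₀ →ᵈ ¬ᵈ (eqᵈ v₀ v₁) →ᵈ Stepᵈ {R} Rᵈ (fs (↑⁶ x)) (fs (↑⁶ y)) (fs (↑⁶ z)) (fs v₅) v₅ v₄ v₃ v₀)))))))
    where
    ↑⁶ : ∀ {m} → Fin m → Fin (6 + m)
    ↑⁶ x = ↑² (↑⁴ x)
    v₅ : ∀ {m} → Fin (6 + m)
    v₅ = fs v₄

-- Multiplication

sumTo : (ℕ → ℕ) → ℕ → ℕ
sumTo f zero    = 0
sumTo f (suc j) = f j + sumTo f j

sumTo-cong : ∀ j {f g : ℕ → ℕ} → (∀ i → f i ≡ g i) → sumTo f j ≡ sumTo g j
sumTo-cong zero    h = refl
sumTo-cong (suc j) h = cong₂ _+_ (h j) (sumTo-cong j h)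

sumTo-cons : ∀ j f → sumTo f (suc j) ≡ f 0 + sumTo (f ∘ suc) j
sumTo-cons zero    f = refl
sumTo-cons (suc j) f = trans (cong (f (suc j) +_) (sumTo-cons j f)) (lemma (f (suc j)) (f 0) (sumTo (f ∘ suc) j))
  where
  lemma : ∀ a b c → a + (b + c) ≡ b + (a + c)
  lemma = solve-∀

sumTo-bound : ∀ j {f : ℕ → ℕ} → (∀ i → f i ≤ 1) → sumTo f j ≤ j
sumTo-bound zero    h = z≤n
sumTo-bound (suc j) h = +-mono-≤ (h j) (sumTo-bound j h)

term : ℕ → ℕ → ℕ → ℕ → ℕ
term x y k j = b2n (bitᵇ x j ∧ bitᵇ y (k ∸ j))

-- The k-th column sum of the schoolbook product of x and y.
column : ℕ → ℕ → ℕ → ℕ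
column x y k = sumTo (term x y k) (suc k)

column≤ : ∀ x y k → column x y k ≤ suc k
column≤ x y k = sumTo-bound (suc k) λ i → b2n≤1 (bitᵇ x i ∧ bitᵇ y (k ∸ i))

b2n-∧ : ∀ a b → b2n (a ∧ b) ≡ b2n a * b2n b
b2n-∧ true  b = sym (*-identityˡ (b2n b))
b2n-∧ false b = refl

column-suc : ∀ x y k → column x y (suc k) ≡ dig x 0 * dig y (suc k) + column (x / 2) y k
column-suc x y k = trans (sumTo-cons (suc k) (term x y (suc k)))
  (cong₂ _+_ (b2n-∧ (bitᵇ x 0) (bitᵇ y (suc k))) (sumTo-cong (suc k) λ i → cong (λ t → b2n (t ∧ bitᵇ y (k ∸ i))) (bit-suc x i)))

zero-or-bit : ∀ x → x ≡ 0 ⊎ ∃ λ i → x ∋ i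
zero-or-bit zero = inj₁ refl
zero-or-bit x@(suc _) with <⇒topBit 0 x (s≤s z≤n)
... | i , h , _ = inj₂ (i , one h)

bits-below⇒< : ∀ m x → (∀ i → x ∋ i → i < m) → x < 2 ^ m
bits-below⇒< m x h with comprehension m (bitᵇ x)
... | a , a< , inside , outside = subst (_< 2 ^ m) (bit-ext a x λ i → ∋-ext a i x i
      (λ m → one (trans (sym (inside i (outside i m))) (isOne m)))
      (λ m → one (trans (inside i (h i m)) (isOne m)))) a<

column-value : ∀ K x y → (∀ i j → x ∋ i → y ∋ j → i + j < K) → bin (column x y) K ≡ x * y
column-value zero x y h with zero-or-bit x | zero-or-bit y
... | inj₁ refl    | _            = refl
... | inj₂ _       | inj₁ refl    = sym (*-zeroʳ x)
... | inj₂ (i , m) | inj₂ (j , l) = ⊥-elim (n≮0 (h i j m l))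
column-value (suc K) x y h = begin
  bin (column x y) (suc K)
    ≡⟨ bin-cons K (column x y) ⟩
  column x y 0 + 2 * bin (column x y ∘ suc) K
    ≡⟨ cong₂ (λ s t → s + 2 * t) (trans (+-identityʳ _) (b2n-∧ (bitᵇ x 0) (bitᵇ y 0))) (trans (bin-cong K λ k _ → column-suc x y k)
         (trans (bin-+ K (λ k → dig x 0 * dig y (suc k)) (column (x / 2) y)) (cong₂ _+_ (bin-*ˡ K (dig x 0) (dig y ∘ suc)) (column-value K (x / 2) y h′)))) ⟩
  dig x 0 * dig y 0 + 2 * (dig x 0 * bin (dig y ∘ suc) K + x / 2 * y)
    ≡⟨ lemma₁ (dig x 0) (dig y 0) (bin (dig y ∘ suc) K) (x / 2 * y) ⟩
  dig x 0 * (dig y 0 + 2 * bin (dig y ∘ suc) K) + 2 * (x / 2 * y)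
    ≡⟨ cong (λ t → dig x 0 * t + 2 * (x / 2 * y)) (bin-cons K (dig y)) ⟨
  dig x 0 * bin (dig y) (suc K) + 2 * (x / 2 * y)
    ≡⟨ cong (_+ 2 * (x / 2 * y)) whole ⟩
  dig x 0 * y + 2 * (x / 2 * y)
    ≡⟨ lemma₂ (dig x 0) (x / 2) y ⟩
  (dig x 0 + 2 * (x / 2)) * y
    ≡⟨ cong (_* y) (half-split x) ⟨
  x * y ∎
  where
  open ≡-Reasoning
  lemma₁ : ∀ a b c d → a * b + 2 * (a * c + d) ≡ a * (b + 2 * c) + 2 * d
  lemma₁ = solve-∀
  lemma₂ : ∀ a b c → a * c + 2 * (b * c) ≡ (a + 2 * b) * c
  lemma₂ = solve-∀
  h′ : ∀ i j → (x / 2) ∋ i → y ∋ j → i + j < K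
  h′ i j m l = <⇒≤pred (h (suc i) j (one (trans (bit-suc x i) (isOne m))) l)
  -- `y` is known to fit into `suc K` bits only if bit 0 of `x` is set; otherwise both sides are 0.
  whole : dig x 0 * bin (dig y) (suc K) ≡ dig x 0 * y
  whole with x ∋? 0
  ... | yes m = cong (dig x 0 *_) (bin-dig (suc K) y (bits-below⇒< (suc K) y λ j → h 0 j m))
  ... | no ¬m = trans (cong (λ t → b2n t * bin (dig y) (suc K)) (∌⇒false {x} {0} ¬m)) (cong (λ t → b2n t * y) (sym (∌⇒false {x} {0} ¬m)))

-- A state is an index with the partial column sum before it; `d` names the difference `k ∸ j`.
ColumnStep : ℕ → ℕ → ℕ → ℕ → State → State → Set
ColumnStep n x y k (j , s) (j′ , s′) =
  suc j ≡ j′ × ∃≤ n λ d → j + d ≡ k × b2n (bitᵇ x j ∧ bitᵇ y d) + s ≡ s′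

Column : ℕ → ℕ → ℕ → ℕ → ℕ → Set
Column n x y k t = ∃≤ n λ k′ → suc k ≡ k′ × ∃≤ n λ o → o ≡ 0 × Leap n (Leap n (ColumnStep n x y k)) (o , o) (k′ , t)

-- The carry rule at column `k`: `s` is the carry in, `s′` the carry out, `t` the column sum, and
-- `g`, `h` name intermediate sums.
CarryStep : ℕ → ℕ → ℕ → ℕ → State → State → Set
CarryStep n x y z (k , s) (k′ , s′) =
  suc k ≡ k′ × ∃≤ n λ t → Column n x y k t × ∃≤ n λ g → s + t ≡ g × ∃≤ n λ h → s′ + s′ ≡ h × b2n (bitᵇ z k) + h ≡ g

-- The number `K` of columns is guessed. The first two clauses ensure that no product of bits and no
-- bit of `z` lies beyond it.
Product : ℕ → ℕ → ℕ → ℕ → Set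
Product n x y z = ∃≤ n λ K →
  (∀≤ n λ i → ∀≤ n λ j → x ∋ i → y ∋ j → ∃≤ n λ l → i + j ≡ l × l < K) ×
  (∀≤ n λ i → z ∋ i → i < K) ×
  ∃≤ n λ o → o ≡ 0 × Leap n (Leap n (CarryStep n x y z)) (o , o) (K , o)

Column-sound : ∀ n x y k t → t ≤ n → Column n x y k t → t ≡ column x y k
Column-sound n x y k t t≤ (_ , k< , refl , _ , _ , refl , path) =
  Leap-preserves n _ Inv (Leap-preserves n _ Inv step) _ _ (s≤s z≤n , s≤s z≤n) (s≤s k< , s≤s t≤) refl path
  where
  Inv : State → Set
  Inv (j , s) = s ≡ sumTo (term x y k) j
  step : Preserves n Inv (ColumnStep n x y k)
  step (j , s) (_ , s′) _ _ inv (refl , d , _ , j+d≡k , e) =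
    trans (sym e) (cong₂ (λ p q → b2n (bitᵇ x j ∧ bitᵇ y p) + q) (trans (sym (m+n∸m≡n j d)) (cong (_∸ j) j+d≡k)) inv)

-- Along the path, the first `k` columns have the value of the first `k` bits of `z` plus 2^k times
-- the carry; at `K` the carry is 0.
Product-sound : ∀ n x y z → x ≤ n → y ≤ n → z ≤ n → Product n x y z → x * y ≡ z
Product-sound n x y z x≤ y≤ z≤ (K , K≤ , below , z-below , _ , _ , refl , path) = begin
  x * y                            ≡⟨ column-value K x y (λ i j m l →
                                        let (_ , _ , e , lt) = below i (≤-trans (<⇒≤ (bit⇒< m)) x≤) j (≤-trans (<⇒≤ (bit⇒< l)) y≤) m l
                                        in subst (_< K) (sym e) lt) ⟨
  bin (column x y) K               ≡⟨ Leap-preserves n _ Inv (Leap-preserves n _ Inv step) _ _ (s≤s z≤n , s≤s z≤n) (s≤s K≤ , s≤s z≤n) refl path ⟩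
  bin (dig z) K + 2 ^ K * 0        ≡⟨ trans (cong (bin (dig z) K +_) (*-zeroʳ (2 ^ K))) (+-identityʳ _) ⟩
  bin (dig z) K                    ≡⟨ bin-dig K z (bits-below⇒< K z λ i m → z-below i (≤-trans (<⇒≤ (bit⇒< m)) z≤) m) ⟩
  z                                ∎
  where
  open ≡-Reasoning
  Inv : State → Set
  Inv (k , s) = bin (column x y) k ≡ bin (dig z) k + 2 ^ k * s
  step : Preserves n Inv (CarryStep n x y z)
  step (k , s) (_ , s′) _ _ inv (refl , t , t≤ , col , _ , _ , refl , _ , _ , refl , e) =
    carry-next _ (bin (dig z) k) (2 ^ k) s (column x y k) (dig z k) s′ inv
      (trans (cong (s +_) (sym (Column-sound n x y k t t≤ col))) (trans (sym e) (cong (λ u → dig z k + (s′ + u)) (sym (+-identityʳ s′)))))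

module _ (n : ℕ) (large : Large n) where
  open Large large

  private
    instance
      2h≢0 : NonZero (2 * h)
      2h≢0 = >-nonZero (≤-trans 1≤h (m≤m+n h _))

    open Record n L (2 * h) (2 ^ h) 2^L≤n fits

    square : 2 ^ h * 2 ^ h ≡ 2 ^ (2 * h)
    square = trans (sym (^-distribˡ-+-* 2 h h)) (cong (λ t → 2 ^ (h + t)) (sym (+-identityʳ h)))

    short : ∀ {k} → k ≤ suc L → k ≤ 2 ^ h * 2 ^ h
    short k≤ = ≤-trans k≤ (≤-trans (<⇒≤ small) (≤-reflexive (sym square)))

    narrow : ∀ {k} → k ≤ suc L → k < 2 ^ (2 * h)
    narrow k≤ = ≤-<-trans k≤ small

    1+L≤n : suc L ≤ n
    1+L≤n = ≤-trans (m≤m+n (suc L) (suc L)) room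

  Column-complete : ∀ x y k → k ≤ L → Column n x y k (column x y k)
  Column-complete x y k k≤L = suc k , ≤-trans (s≤s k≤L) 1+L≤n , refl , 0 , z≤n , refl ,
    Leap²-complete (ColumnStep n x y k) (λ j → j , sumTo (term x y k) j) (suc k) (short (s≤s k≤L))
      (λ j j≤k → refl , k ∸ j , ≤-trans (m∸n≤m k j) (≤-trans k≤L (≤-trans (n≤1+n L) 1+L≤n)) , m+[n∸m]≡n (<⇒≤pred j≤k) , refl)
      (λ j j≤ → narrow (≤-trans j≤ (s≤s k≤L)) ,
                narrow (≤-trans (sumTo-bound j λ i → b2n≤1 (bitᵇ x i ∧ bitᵇ y (k ∸ i))) (≤-trans j≤ (s≤s k≤L))))

  -- The witnesses are `K = suc L`, since each product of bits weighs at most `z ≤ n < 2 ^ suc L`,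
  -- and the true carries.
  Product-complete : ∀ x y z → z ≤ n → x * y ≡ z → Product n x y z
  Product-complete x y z z≤ e = suc L , 1+L≤n , x-y-below , (λ i _ m → 2^≤n⇒< (≤-trans (bit⇒2^≤ m) z≤)) , 0 , z≤n , refl ,
    subst (λ t → Leap n (Leap n (CarryStep n x y z)) (0 , 0) (suc L , t)) (proj₁ outcome)
      (Leap²-complete (CarryStep n x y z) (λ k → k , carry k) (suc L) (short ≤-refl) step
        (λ k k≤ → narrow k≤ , narrow (≤-trans (carry≤ k) k≤)))
    where
    open Carries (column x y)
    2^≤n⇒< : ∀ {i} → 2 ^ i ≤ n → i < suc L
    2^≤n⇒< p = ≰⇒> λ L<i → <⇒≱ n<2^1+L (≤-trans (^-monoʳ-≤ 2 L<i) p)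
    sum-below : ∀ i j → x ∋ i → y ∋ j → i + j < suc L
    sum-below i j m l = 2^≤n⇒< (begin
      2 ^ (i + j)      ≡⟨ ^-distribˡ-+-* 2 i j ⟩
      2 ^ i * 2 ^ j    ≤⟨ *-mono-≤ (bit⇒2^≤ m) (bit⇒2^≤ l) ⟩
      x * y            ≡⟨ e ⟩
      z                ≤⟨ z≤ ⟩
      n                ∎)
      where open ≤-Reasoning
    x-y-below : ∀≤ n λ i → ∀≤ n λ j → x ∋ i → y ∋ j → ∃≤ n λ l → i + j ≡ l × l < suc L
    x-y-below i _ j _ m l = i + j , ≤-trans (<⇒≤ (sum-below i j m l)) 1+L≤n , refl , sum-below i j m l
    outcome : carry (suc L) ≡ 0 × (∀ k → k < suc L → bitᵇ z k ≡ out k)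
    outcome = carry-result (suc L) z (≤-<-trans z≤ n<2^1+L) (trans (column-value (suc L) x y sum-below) e)
    -- Column `k` is at most `suc k`, so halving `k + suc k` gives less than `suc k`; hence all
    -- carries fit into the fields.
    carry≤ : ∀ k → carry k ≤ k
    carry≤ zero    = z≤n
    carry≤ (suc k) = <⇒≤ (m<n*o⇒m/o<n (begin-strict
      carry k + column x y k   ≤⟨ +-mono-≤ (carry≤ k) (column≤ x y k) ⟩
      k + suc k                <⟨ n<1+n _ ⟩
      suc k + suc k            ≡⟨ lemma (suc k) ⟩
      suc k * 2                ∎))
      where
      open ≤-Reasoning
      lemma : ∀ k → k + k ≡ k * 2
      lemma = solve-∀
    step : ∀ k → k < suc L → CarryStep n x y z (k , carry k) (suc k , carry (suc k))
    step k k<@(s≤s k≤L) = refl , column x y k , ≤-trans (column≤ x y k) (≤-trans (s≤s k≤L) 1+L≤n) , Column-complete x y k k≤L ,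
      carry k + column x y k , g≤n , refl , carry (suc k) + carry (suc k) , ≤-trans (≤-trans (m≤n+m _ (dig z k)) (≤-reflexive balance)) g≤n , refl , balance
      where
      g≤n : carry k + column x y k ≤ n
      g≤n = ≤-trans (+-mono-≤ (≤-trans (carry≤ k) (<⇒≤ k<)) (≤-trans (column≤ x y k) (s≤s k≤L))) room
      balance : b2n (bitᵇ z k) + (carry (suc k) + carry (suc k)) ≡ carry k + column x y k
      balance = sym (trans (carry-step k) (cong₂ (λ s t → b2n s + (carry (suc k) + t)) (sym (proj₂ outcome k k<)) (+-identityʳ _)))

module _ {σ : Vocab} {n₀ : ℕ} (large : ∀ n → n₀ ≤ n → Large n) (1≤n₀ : 1 ≤ n₀) where

  ColumnStepᵈ : DefRel σ n₀ ColumnStep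
  ColumnStepᵈ x y k j s j′ s′ = sucᵈ j j′ ×ᵈ ∃ᵈ (sumᵈ 1≤n₀ (fs j) v₀ (fs k) ×ᵈ
    caseᵈ {F = λ b _ e → b2n b + e (fs s) ≡ e (fs s′)} {g = λ _ e → bitᵇ (e (fs x)) (e (fs j)) ∧ bitᵇ (e (fs y)) (e v₀)}
      (respᵈ (λ n e _ _ → lemma (bitᵇ (e (fs x)) (e (fs j)))) (bitᵇᵈ (fs x) (fs j) ×ᵈ bitᵇᵈ (fs y) v₀))
      (λ { true → sucᵈ (fs s) (fs s′) ; false → eqᵈ (fs s) (fs s′) }))
    where
    lemma : ∀ a {b} → (a ≡ true × b ≡ true) ⟺ (a ∧ b ≡ true)
    lemma true  = proj₂ , λ p → refl , p
    lemma false = proj₁ , λ ()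

  Columnᵈ : ∀ {m} (x y k t : Fin m) → Def σ n₀ m (λ n e → Column n (e x) (e y) (e k) (e t))
  Columnᵈ x y k t = ∃ᵈ (sucᵈ (fs k) v₀ ×ᵈ ∃ᵈ (zeroᵈ v₀ ×ᵈ
    Leapᵈ 1≤n₀ {λ n x y k → Leap n (ColumnStep n x y k)} (Leapᵈ 1≤n₀ {ColumnStep} ColumnStepᵈ) (↑² x) (↑² y) (↑² k) v₀ v₀ v₁ (↑² t)))

  CarryStepᵈ : DefRel σ n₀ CarryStep
  CarryStepᵈ x y z k s k′ s′ = sucᵈ k k′ ×ᵈ ∃ᵈ (Columnᵈ (fs x) (fs y) (fs k) v₀ ×ᵈ ∃ᵈ (sumᵈ 1≤n₀ (↑² s) v₁ v₀ ×ᵈ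
    ∃ᵈ (sumᵈ 1≤n₀ (↑³ s′) (↑³ s′) v₀ ×ᵈ
      caseᵈ {F = λ b _ e → b2n b + e v₀ ≡ e v₁} {g = λ _ e → bitᵇ (e (↑³ z)) (e (↑³ k))} (bitᵇᵈ (↑³ z) (↑³ k))
        (λ { true → sucᵈ v₀ v₁ ; false → eqᵈ v₀ v₁ }))))

  productᵈ : ∀ {m} (x y z : Fin m) → Def σ n₀ m (λ n e → e x * e y ≡ e z)
  productᵈ x y z = respᵈ (λ n e n₀≤ bnd → Product-sound n (e x) (e y) (e z) (bnd x) (bnd y) (bnd z) ,
                                         Product-complete n (large n n₀≤) (e x) (e y) (e z) (bnd z))
    (∃ᵈ (∀ᵈ (∀ᵈ (bitᵈ (↑³ x) v₁ →ᵈ bitᵈ (↑³ y) v₀ →ᵈ ∃ᵈ (sumᵈ 1≤n₀ v₂ v₁ v₀ ×ᵈ v₀ <ᵈ v₃))) ×ᵈ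
      ∀ᵈ (bitᵈ (↑² z) v₀ →ᵈ v₀ <ᵈ v₁) ×ᵈ
      ∃ᵈ (zeroᵈ v₀ ×ᵈ Leapᵈ 1≤n₀ {λ n x y z → Leap n (CarryStep n x y z)} (Leapᵈ 1≤n₀ {CarryStep} CarryStepᵈ) (↑² x) (↑² y) (↑² z) v₀ v₀ v₁ v₀)))

-- Defining ⊏

q-from-double : ∀ i z → i * suc i ≡ z * 2 → q i ≡ z
q-from-double i z e = trans (cong (_/ 2) e) (m*n/n≡m z 2)

q-even : ∀ h → q (h + h) ≡ h * (h + h) + h
q-even h = q-from-double (h + h) (h * (h + h) + h) (lemma h)
  where
  lemma : ∀ h → (h + h) * suc (h + h) ≡ (h * (h + h) + h) * 2
  lemma = solve-∀

q-odd : ∀ h → q (suc (h + h)) ≡ h * suc (h + h) + suc (h + h)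
q-odd h = q-from-double (suc (h + h)) (h * suc (h + h) + suc (h + h)) (lemma h)
  where
  lemma : ∀ h → suc (h + h) * suc (suc (h + h)) ≡ (h * suc (h + h) + suc (h + h)) * 2
  lemma = solve-∀

parity : ∀ i → ∃ λ h → i ≡ h + h ⊎ i ≡ suc (h + h)
parity zero = 0 , inj₁ refl
parity (suc i) with parity i
... | h , inj₁ refl = h , inj₂ refl
... | h , inj₂ refl = suc h , inj₁ (cong suc (sym (+-suc h h)))

q-suc : ∀ i → q (suc i) ≡ suc i + q i
q-suc i with parity i
... | h , inj₁ refl = trans (q-odd h) (trans (lemma h) (cong (suc (h + h) +_) (sym (q-even h))))
  where
  lemma : ∀ h → h * suc (h + h) + suc (h + h) ≡ suc (h + h) + (h * (h + h) + h)
  lemma = solve-∀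
... | h , inj₂ refl = trans (cong q (cong suc (sym (+-suc h h)))) (trans (q-even (suc h)) (trans (lemma h) (cong (suc (suc (h + h)) +_) (sym (q-odd h)))))
  where
  lemma : ∀ h → suc h * (suc h + suc h) + suc h ≡ suc (suc (h + h)) + (h * suc (h + h) + suc (h + h))
  lemma = solve-∀

q-mono : ∀ {i j} → i ≤ j → q i ≤ q j
q-mono {i} {zero}  z≤n = ≤-refl
q-mono {i} {suc j} i≤  with m≤n⇒m<n∨m≡n i≤
... | inj₁ (s≤s i≤j) = ≤-trans (q-mono i≤j) (≤-trans (m≤n+m (q j) (suc j)) (≤-reflexive (sym (q-suc j))))
... | inj₂ refl      = ≤-refl

i≤q : ∀ i → i ≤ q i
i≤q zero    = z≤n
i≤q (suc i) = ≤-trans (m≤m+n (suc i) (q i)) (≤-reflexive (sym (q-suc i)))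

cSearch-unique : ∀ k x i → q i ≤ x → x < q (suc i) → i ≤ k → cSearch x k ≡ i
cSearch-unique zero    x zero lo hi z≤n = refl
cSearch-unique (suc k) x i lo hi i≤ with q (suc k) ≤ᵇ x in e
... | true = ≤-antisym (≮⇒≥ λ i<sk → <⇒≱ hi (≤-trans (q-mono i<sk) (≤ᵇ⇒≤ (q (suc k)) x (≡⇒T e)))) i≤
... | false with m≤n⇒m<n∨m≡n i≤
... | inj₁ (s≤s i≤k) = cSearch-unique k x i lo hi i≤k
... | inj₂ refl      = ⊥-elim (subst T e (≤⇒≤ᵇ lo))

c-unique : ∀ i s → s ≤ i → c (q i + s) ≡ i
c-unique i s s≤i = cSearch-unique (q i + s) (q i + s) i (m≤m+n (q i) s)
  (subst (q i + s <_) (trans (+-comm (q i) (suc i)) (sym (q-suc i))) (+-monoʳ-< (q i) (s≤s s≤i)))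
  (≤-trans (i≤q i) (m≤m+n (q i) s))

r-unique : ∀ i s → s ≤ i → r (q i + s) ≡ s
r-unique i s s≤i = trans (cong (λ t → q i + s ∸ q t) (c-unique i s s≤i)) (m+n∸m≡n (q i) s)

decompose : ∀ x → ∃ λ i → ∃ λ s → q i + s ≡ x × s ≤ i
decompose zero = 0 , 0 , refl , z≤n
decompose (suc x) with decompose x
... | i , s , refl , s≤i with m≤n⇒m<n∨m≡n s≤i
... | inj₁ s<i  = i , suc s , +-suc (q i) s , s<i
... | inj₂ refl = suc i , 0 , trans (+-identityʳ (q (suc i))) (trans (q-suc i) (cong suc (+-comm i (q i)))) , z≤n

cell : ∀ x → q (c x) + r x ≡ x × r x ≤ c x
cell x with decompose x
... | i , s , refl , s≤i = cong₂ (λ a b → q a + b) (c-unique i s s≤i) (r-unique i s s≤i) ,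
                           ≤-trans (≤-reflexive (r-unique i s s≤i)) (≤-trans s≤i (≤-reflexive (sym (c-unique i s s≤i))))

c≤ : ∀ x → c x ≤ x
c≤ x = ≤-trans (i≤q (c x)) (≤-trans (m≤m+n (q (c x)) (r x)) (≤-reflexive (proj₁ (cell x))))

_⊏_ : ℕ → ℕ → Set
x ⊏ y = r x < r y ⊎ (r x ≡ r y × c x < c y)

⊏ᵇ-true : ∀ x y → (x ⊏ᵇ y ≡ true) ⟺ (x ⊏ y)
⊏ᵇ-true x y = lemma (<ᵇ-true (r x) (r y)) (≡ᵇ-true (r x) (r y)) (<ᵇ-true (c x) (c y))
  where
  lemma : ∀ {a b d A B D} → (a ≡ true) ⟺ A → (b ≡ true) ⟺ B → (d ≡ true) ⟺ D → (a ∨ (b ∧ d) ≡ true) ⟺ (A ⊎ (B × D))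
  lemma {true}  (f , _) _ _ = (λ _ → inj₁ (f refl)) , λ _ → refl
  lemma {false} {true} (_ , g) (f , _) (h , k) = (λ p → inj₂ (f refl , h p)) , λ { (inj₁ x) → absurd (sym (g x)) ; (inj₂ (_ , y)) → k y }
  lemma {false} {false} (_ , g) (_ , f) _ = (λ ()) , λ { (inj₁ x) → g x ; (inj₂ (y , _)) → f y }

-- Halving comes before multiplying: `i * suc i` may exceed n although `q i` does not, whereas
-- `h * i` and `h + h` are at most `q i`. The cases are `i = 2h` and `i = 2h + 1`.
Triangular : ℕ → ℕ → ℕ → Set
Triangular n i z = ∃≤ n λ h → ∃≤ n λ w → h * i ≡ w × ∃≤ n λ g → h + h ≡ g ×
  ((g ≡ i × w + h ≡ z) ⊎ (suc g ≡ i × w + i ≡ z))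

Triangular⟺q : ∀ n i z → z ≤ n → Triangular n i z ⟺ (q i ≡ z)
Triangular⟺q n i z z≤ = to , from
  where
  to : Triangular n i z → q i ≡ z
  to (h , _ , _ , _ , refl , _ , _ , refl , inj₁ (refl , e)) = trans (q-even h) e
  to (h , _ , _ , _ , refl , _ , _ , refl , inj₂ (refl , e)) = trans (q-odd h) e
  from : q i ≡ z → Triangular n i z
  from e with parity i
  ... | h , inj₁ refl = h , ≤-trans (m≤m+n h h) i≤n , h * i , ≤-trans (m≤m+n (h * i) h) (≤-trans (≤-reflexive value) z≤) , refl ,
                        h + h , i≤n , refl , inj₁ (refl , value)
    where
    value : h * i + h ≡ z
    value = trans (sym (q-even h)) e
    i≤n : i ≤ n
    i≤n = ≤-trans (i≤q i) (≤-trans (≤-reflexive e) z≤)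
  ... | h , inj₂ refl = h , ≤-trans (m≤m+n h h) g≤n , h * i , ≤-trans (m≤m+n (h * i) i) (≤-trans (≤-reflexive value) z≤) , refl ,
                        h + h , g≤n , refl , inj₂ (refl , value)
    where
    value : h * i + i ≡ z
    value = trans (sym (q-odd h)) e
    g≤n : h + h ≤ n
    g≤n = ≤-trans (n≤1+n (h + h)) (≤-trans (i≤q i) (≤-trans (≤-reflexive e) z≤))

Cell : ℕ → ℕ → ℕ → ℕ → Set
Cell n x i s = ∃≤ n λ z → q i ≡ z × z + s ≡ x × ¬ (i < s)

Cell⟺ : ∀ n x i s → x ≤ n → Cell n x i s ⟺ (c x ≡ i × r x ≡ s)
Cell⟺ n x i s x≤ = to , from
  where
  to : Cell n x i s → c x ≡ i × r x ≡ s
  to (_ , _ , refl , refl , i≮s) = c-unique i s (≮⇒≥ i≮s) , r-unique i s (≮⇒≥ i≮s)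
  from : c x ≡ i × r x ≡ s → Cell n x i s
  from (refl , refl) = q (c x) , ≤-trans (≤-trans (m≤m+n _ (r x)) (≤-reflexive (proj₁ (cell x)))) x≤ , refl , cell x .proj₁ , ≤⇒≯ (proj₂ (cell x))

Before : ℕ → ℕ → ℕ → Set
Before n x y = ∃≤ n λ i → ∃≤ n λ s → ∃≤ n λ j → ∃≤ n λ t →
  (c x ≡ i × r x ≡ s) × (c y ≡ j × r y ≡ t) × (s < t ⊎ (s ≡ t × i < j))

Before⟺⊏ : ∀ n x y → x ≤ n → y ≤ n → Before n x y ⟺ (x ⊏ y)
Before⟺⊏ n x y x≤ y≤ = (λ { (_ , _ , _ , _ , _ , _ , _ , _ , (refl , refl) , (refl , refl) , p) → p }) ,
  λ p → c x , ≤-trans (c≤ x) x≤ , r x , ≤-trans (m∸n≤m x (q (c x))) x≤ , c y , ≤-trans (c≤ y) y≤ , r y , ≤-trans (m∸n≤m y (q (c y))) y≤ ,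
        (refl , refl) , (refl , refl) , p

-- The threshold for `Large`

fits-from-5 : ∀ k → suc (2 * (6 + k) * suc (2 ^ (6 + k))) ≤ 4 ^ (5 + k)
-- The base case is 781 ≤ 1024; one exponent lower it would be 331 ≤ 256. From there the left side
-- grows by a factor below 4 per step.
fits-from-5 zero    = ≤ᵇ⇒≤ 781 1024 _
fits-from-5 (suc k) = begin
  suc (2 * (7 + k) * suc (2 * p))                                             ≤⟨ m≤m+n _ _ ⟩
  suc (2 * (7 + k) * suc (2 * p)) + (37 + 6 * k + 20 * p + 4 * (k * p))       ≡⟨ lemma k p ⟩
  4 * suc (2 * (6 + k) * suc p)                                               ≤⟨ *-monoʳ-≤ 4 (fits-from-5 k) ⟩
  4 ^ (6 + k)                                                                 ∎
  where
  open ≤-Reasoning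
  p = 2 ^ (6 + k)
  lemma : ∀ k p → suc (2 * (7 + k) * suc (2 * p)) + (37 + 6 * k + 20 * p + 4 * (k * p)) ≡ 4 * suc (2 * (6 + k) * suc p)
  lemma = solve-∀

^-cancel-≤ : ∀ b {i j} → 1 ≤ b → b ^ i < b ^ suc j → i ≤ j
^-cancel-≤ b {i} {j} 1≤b lt = ≮⇒≥ λ j<i → <⇒≱ lt (^-monoʳ-≤ b {{>-nonZero 1≤b}} j<i)

double-below-2^ : ∀ j → suc (3 + j) + suc (3 + j) ≤ 2 ^ (3 + j)
double-below-2^ zero    = ≤-refl
double-below-2^ (suc j) = begin
  suc (4 + j) + suc (4 + j)                               ≡⟨ lemma j ⟩
  2 + (suc (3 + j) + suc (3 + j))                         ≤⟨ +-mono-≤ {2} {suc (3 + j) + suc (3 + j)} (s≤s (s≤s z≤n)) (double-below-2^ j) ⟩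
  suc (3 + j) + suc (3 + j) + 2 ^ (3 + j)                 ≤⟨ +-monoˡ-≤ (2 ^ (3 + j)) (double-below-2^ j) ⟩
  2 ^ (3 + j) + 2 ^ (3 + j)                               ≡⟨ cong (2 ^ (3 + j) +_) (sym (+-identityʳ _)) ⟩
  2 ^ (4 + j)                                             ∎
  where
  open ≤-Reasoning
  lemma : ∀ j → suc (4 + j) + suc (4 + j) ≡ 2 + (suc (3 + j) + suc (3 + j))
  lemma = solve-∀

large-from : ∀ n → 2 ^ (4 ^ 5) ≤ n → Large n
large-from n n≥ with floor-log 2 n ≤-refl (≤-trans (m^n>0 2 (4 ^ 5)) n≥)
... | L , 2^L≤n , n< with floor-log 4 (suc L) (s≤s (s≤s z≤n)) (s≤s z≤n)
... | k , 4^k≤ , 1+L< = record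
  -- As `4 ^ k ≤ suc L < 4 ^ suc k`, this `2 ^ h` lies between one and two times the square root of
  -- `suc L`: the upper bound on `suc L` yields `small`, the lower one `fits`.
  { L = L ; h = suc k ; 2^L≤n = 2^L≤n ; n<2^1+L = n<
  ; small = subst (suc L <_) (^-*-assoc 2 2 (suc k)) 1+L<
  ; fits  = <⇒≤pred (≤-trans (subst (λ t → suc (2 * suc t * suc (2 ^ suc t)) ≤ 4 ^ t) (m+[n∸m]≡n 5≤k) (fits-from-5 (k ∸ 5))) 4^k≤)
  ; 1≤h   = s≤s z≤n
  ; room  = ≤-trans (subst (λ t → suc t + suc t ≤ 2 ^ t) (m+[n∸m]≡n 3≤L) (double-below-2^ (L ∸ 3))) 2^L≤n
  }
  where
  4^5≤L : 4 ^ 5 ≤ L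
  4^5≤L = ^-cancel-≤ 2 (s≤s z≤n) (≤-<-trans n≥ n<)
  5≤k : 5 ≤ k
  5≤k = ^-cancel-≤ 4 {5} (s≤s z≤n) (≤-<-trans 4^5≤L (<-trans (n<1+n L) 1+L<))
  3≤L : 3 ≤ L
  3≤L = ≤-trans (≤ᵇ⇒≤ 3 1024 _) 4^5≤L

abstract
  -- Opaque, because `∃<ᵈ n₀` recurses on the threshold and must not be unfolded up to 2^1024.
  threshold : ∃ λ n₀ → 1 ≤ n₀ × (∀ n → n₀ ≤ n → Large n)
  threshold = 2 ^ (4 ^ 5) , m^n>0 2 (4 ^ 5) , large-from

n₀ : ℕ
n₀ = proj₁ threshold

1≤n₀ : 1 ≤ n₀
1≤n₀ = proj₁ (proj₂ threshold)

large : ∀ n → n₀ ≤ n → Large n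
large = proj₂ (proj₂ threshold)

-- Translating formulas

module _ {σ : Vocab} where

  triangularᵈ : ∀ {m} (i z : Fin m) → Def σ n₀ m (λ n e → q (e i) ≡ e z)
  triangularᵈ i z = respᵈ (λ n e _ bnd → Triangular⟺q n (e i) (e z) (bnd z))
    (∃ᵈ (∃ᵈ (productᵈ large 1≤n₀ v₁ (↑² i) v₀ ×ᵈ ∃ᵈ (sumᵈ 1≤n₀ v₂ v₂ v₀ ×ᵈ
      ((eqᵈ v₀ (↑³ i) ×ᵈ sumᵈ 1≤n₀ v₁ v₂ (↑³ z)) ⊎ᵈ (sucᵈ v₀ (↑³ i) ×ᵈ sumᵈ 1≤n₀ v₁ (↑³ i) (↑³ z)))))))

  cellᵈ : ∀ {m} (x i s : Fin m) → Def σ n₀ m (λ n e → c (e x) ≡ e i × r (e x) ≡ e s)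
  cellᵈ x i s = respᵈ (λ n e _ bnd → Cell⟺ n (e x) (e i) (e s) (bnd x))
    (∃ᵈ (triangularᵈ (fs i) v₀ ×ᵈ sumᵈ 1≤n₀ v₀ (fs s) (fs x) ×ᵈ ¬ᵈ (fs i <ᵈ fs s)))

  beforeᵈ : ∀ {m} (x y : Fin m) → Def σ n₀ m (λ n e → e x ⊏ e y)
  beforeᵈ x y = respᵈ (λ n e _ bnd → Before⟺⊏ n (e x) (e y) (bnd x) (bnd y))
    (∃ᵈ (∃ᵈ (∃ᵈ (∃ᵈ (cellᵈ (↑⁴ x) v₃ v₂ ×ᵈ cellᵈ (↑⁴ y) v₁ v₀ ×ᵈ (v₂ <ᵈ v₀ ⊎ᵈ (eqᵈ v₂ v₀ ×ᵈ v₃ <ᵈ v₁)))))))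

  numeralᵈ : ∀ j {m} (x : Fin m) → Def σ 0 m (λ n e → e x ≡ j)
  numeralᵈ zero    x = zeroᵈ x
  numeralᵈ (suc j) x = respᵈ (λ n e _ bnd → (λ { (_ , _ , refl , p) → sym p }) ,
                                           λ p → j , ≤-trans (n≤1+n j) (subst (_≤ n) p (bnd x)) , refl , sym p)
    (∃ᵈ (numeralᵈ j v₀ ×ᵈ sucᵈ v₀ (fs x)))

  ∃<ᵈ : ∀ N {m} {P : ℕ → Pred m} → (∀ j → Def σ 0 m (P j)) → Def σ 0 m (λ n e → ∃ λ j → j < N × P j n e)
  ∃<ᵈ zero    P = respᵈ (λ n e _ _ → (λ ()) , λ { (_ , () , _) }) (constᵈ {X = ⊥} (no id))
  ∃<ᵈ (suc N) {P = P} Pᵈ = respᵈ (λ n e _ _ → (λ { (inj₁ (j , j< , p)) → j , m≤n⇒m≤1+n j< , p ; (inj₂ p) → N , ≤-refl , p }) , split n e)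
    (∃<ᵈ N Pᵈ ⊎ᵈ Pᵈ N)
    where
    split : ∀ n e → (∃ λ j → j < suc N × P j n e) → (∃ λ j → j < N × P j n e) ⊎ P N n e
    split n e (j , s≤s j≤ , p) with m≤n⇒m<n∨m≡n j≤
    ... | inj₁ j<   = inj₁ (j , j< , p)
    ... | inj₂ refl = inj₂ p

  -- The test `β` asks for an element equal to `N`. The gluing is done on bare formulas because
  -- nothing is known about `φ` below `N`, while the connectives on `Def` share one threshold.
  ifᵈ : ∀ N {m} {P Q : Pred m} → Def σ N m P → Def σ 0 m Q →
        (∀ n e → n < N → (∀ i → e i ≤ n) → Q n e ⟺ P n e) → Def σ 0 m P
  ifᵈ N {m} {P} {Q} (def φ ok) (def ψ ok′) agree =
    def (neg (conj (neg (conj β φ)) (neg (conj (neg β) ψ)))) correct′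
    where
    big : Def σ 0 m (λ n e → N ≤ n)
    big = respᵈ (λ n e _ _ → (λ { (_ , p , refl) → p }) , λ p → N , p , refl) (∃ᵈ (numeralᵈ N v₀))
    β = formula big
    select : ∀ {B X} b f g → (b ≡ true) ⟺ B → (B → (f ≡ true) ⟺ X) → (¬ B → (g ≡ true) ⟺ X) →
             (not (not (b ∧ f) ∧ not (not b ∧ g)) ≡ true) ⟺ X
    select true  f g (B , _) h _ with h (B refl)
    select true  true  g _ _ _ | k = k
    select true  false g _ _ _ | k = k
    select false f g (_ , B) _ h with h (λ x → absurd (sym (B x)))
    select false f true  _ _ _ | k = k
    select false f false _ _ _ | k = k
    correct′ : ∀ n → 0 ≤ n → ∀ A ρ e → (∀ i → toℕ (ρ i) ≡ e i) →
               (eval n A ρ (neg (conj (neg (conj β φ)) (neg (conj (neg β) ψ)))) ≡ true) ⟺ P n e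
    correct′ n _ A ρ e h = select (eval n A ρ β) (eval n A ρ φ) (eval n A ρ ψ) (correct big n z≤n A ρ e h)
      (λ N≤n → ok n N≤n A ρ e h)
      (λ N≰n → ⟺-trans (ok′ n z≤n A ρ e h) (agree n e (≰⇒> N≰n) λ i → subst (_≤ n) (h i) (<⇒≤pred (toℕ<n (ρ i)))))

  _⊏ᵈ_ : ∀ {m} (x y : Fin m) → Def σ 0 m (λ n e → e x ⊏ e y)
  x ⊏ᵈ y = ifᵈ n₀ (beforeᵈ x y)
    -- Below the threshold the relation is a finite list of pairs, decided outside the logic.
    (∃<ᵈ n₀ λ j → ∃<ᵈ n₀ λ k → numeralᵈ j x ×ᵈ numeralᵈ k y ×ᵈ constᵈ (j ⊏? k))
    (λ n e n<n₀ bnd → (λ { (_ , _ , _ , _ , refl , refl , p) → p }) ,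
                      λ p → e x , ≤-<-trans (bnd x) n<n₀ , e y , ≤-<-trans (bnd y) n<n₀ , refl , refl , p)
    where
    _⊏?_ : ∀ j k → Dec (j ⊏ k)
    j ⊏? k with j ⊏ᵇ k in e
    ... | true  = yes (proj₁ (⊏ᵇ-true j k) e)
    ... | false = no λ p → absurd (trans (sym (proj₂ (⊏ᵇ-true j k) p)) e)

  translate : ∀ {m} → Formula σ LtSq m → Formula σ BitSig m
  translate (eq x y)                   = eq x y
  translate (rel i xs)                 = rel i xs
  translate (num fz (x ∷ y ∷ []))      = formula {n₀ = 0} (x <ᵈ y)
  translate (num (fs fz) (x ∷ y ∷ [])) = formula (x ⊏ᵈ y)
  translate (neg φ)                    = neg (translate φ)
  translate (conj φ ψ)                 = conj (translate φ) (translate ψ)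
  translate (ex φ)                     = ex (translate φ)

  anyFin-cong : ∀ k {f g : Fin k → Bool} → (∀ i → f i ≡ g i) → anyFin k f ≡ anyFin k g
  anyFin-cong zero    h = refl
  anyFin-cong (suc k) h = cong₂ _∨_ (h fz) (anyFin-cong k (h ∘ fs))

  translate-correct : ∀ {m} (φ : Formula σ LtSq m) n (A : Structure σ n) ρ → eval n A ρ φ ≡ eval n A ρ (translate φ)
  translate-correct (eq x y) n A ρ = refl
  translate-correct (rel i xs) n A ρ = refl
  translate-correct (num fz (x ∷ y ∷ [])) n A ρ = true⟺⇒≡ (⟺-trans (<ᵇ-true (toℕ (ρ x)) (toℕ (ρ y)))
    (⟺-sym (correct {σ} {0} (x <ᵈ y) n z≤n A ρ (toℕ ∘ ρ) λ _ → refl)))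
  translate-correct (num (fs fz) (x ∷ y ∷ [])) n A ρ = true⟺⇒≡ (⟺-trans (⊏ᵇ-true (toℕ (ρ x)) (toℕ (ρ y)))
    (⟺-sym (correct (x ⊏ᵈ y) n z≤n A ρ (toℕ ∘ ρ) λ _ → refl)))
  translate-correct (neg φ) n A ρ = cong not (translate-correct φ n A ρ)
  translate-correct (conj φ ψ) n A ρ = cong₂ _∧_ (translate-correct φ n A ρ) (translate-correct ψ n A ρ)
  translate-correct (ex φ) n A ρ = anyFin-cong (suc n) λ a → translate-correct φ n A (extend ρ a)

-- The game on two triangles

-- Equality up to a threshold, the usual invariant for gaps in games on linear orders.
_~[_]_ : ℕ → ℕ → ℕ → Set
m ~[ D ] n = m ≡ n ⊎ (D ≤ m × D ≤ n)

~-sym : ∀ {D m n} → m ~[ D ] n → n ~[ D ] m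
~-sym (inj₁ e)       = inj₁ (sym e)
~-sym (inj₂ (p , q)) = inj₂ (q , p)

~-weaken : ∀ {D E m n} → D ≤ E → m ~[ E ] n → m ~[ D ] n
~-weaken D≤E (inj₁ e)       = inj₁ e
~-weaken D≤E (inj₂ (p , q)) = inj₂ (≤-trans D≤E p , ≤-trans D≤E q)

~-+ : ∀ {D m n m′ n′} → m ~[ D ] m′ → n ~[ D ] n′ → (m + n) ~[ D ] (m′ + n′)
~-+ (inj₁ e) (inj₁ e′) = inj₁ (cong₂ _+_ e e′)
~-+ {m = m} {m′ = m′} _ (inj₂ (p , q)) = inj₂ (≤-trans p (m≤n+m _ m) , ≤-trans q (m≤n+m _ m′))
~-+ (inj₂ (p , q)) (inj₁ _) = inj₂ (≤-trans p (m≤m+n _ _) , ≤-trans q (m≤m+n _ _))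

0~⇒0 : ∀ {D n} → 1 ≤ D → 0 ~[ D ] n → n ≡ 0
0~⇒0 1≤D (inj₁ e)       = sym e
0~⇒0 1≤D (inj₂ (p , _)) = ⊥-elim (<⇒≱ 1≤D p)

-- A part shorter than `D` is copied and the other takes the rest; if neither is short, `D` and the
-- rest will do. Threshold `2 * D` leaves at least `D` for the rest.
~-split : ∀ D x y s → (x + y) ~[ 2 * D ] s → ∃ λ x′ → ∃ λ y′ → x′ + y′ ≡ s × x ~[ D ] x′ × y ~[ D ] y′
~-split D x y s (inj₁ e) = x , y , e , inj₁ refl , inj₁ refl
~-split D x y s (inj₂ (p , p′)) = split (x <? D) (y <? D)
  where
  D+D≤2D : D + D ≤ 2 * D
  D+D≤2D = ≤-reflexive (cong (D +_) (sym (+-identityʳ D)))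
  D≤s : D ≤ s
  D≤s = ≤-trans (m≤m+n D _) p′
  split : Dec (x < D) → Dec (y < D) → ∃ λ x′ → ∃ λ y′ → x′ + y′ ≡ s × x ~[ D ] x′ × y ~[ D ] y′
  split (yes x<D) _ = x , s ∸ x , m+[n∸m]≡n (≤-trans (<⇒≤ x<D) D≤s) , inj₁ refl ,
    inj₂ (+-cancelˡ-≤ x D y (≤-trans x+D≤2D p) , m+n≤o⇒m≤o∸n D (subst (_≤ s) (+-comm x D) (≤-trans x+D≤2D p′)))
    where
    x+D≤2D : x + D ≤ 2 * D
    x+D≤2D = ≤-trans (+-monoˡ-≤ D (<⇒≤ x<D)) D+D≤2D
  split (no _) (yes y<D) = s ∸ y , y , m∸n+n≡m (≤-trans (<⇒≤ y<D) D≤s) ,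
    inj₂ (+-cancelʳ-≤ y D x (≤-trans D+y≤2D p) , m+n≤o⇒m≤o∸n D (≤-trans D+y≤2D p′)) , inj₁ refl
    where
    D+y≤2D : D + y ≤ 2 * D
    D+y≤2D = ≤-trans (+-monoʳ-≤ D (<⇒≤ y<D)) D+D≤2D
  split (no x≮D) (no y≮D) = D , s ∸ D , m+[n∸m]≡n D≤s , inj₂ (≮⇒≥ x≮D , ≤-refl) ,
    inj₂ (≮⇒≥ y≮D , m+n≤o⇒m≤o∸n D (≤-trans D+D≤2D p′))

-- Positions of a game on two linear orders: pairs of corresponding points.
Points : Set
Points = List (ℕ × ℕ)

-- Truncated differences in both directions record the gaps and, as only 0 is `~[ D ]`-related to 0
-- for `D ≥ 1`, also the order.
Close : ℕ → Points → Set
Close D P = ∀ {u v} → u ∈ P → v ∈ P → (proj₁ u ∸ proj₁ v) ~[ D ] (proj₂ u ∸ proj₂ v)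

Close-swap : ∀ {D P} → Close D P → Close D (map swap P)
Close-swap cl u v with ∈-map⁻ swap u | ∈-map⁻ swap v
... | _ , u∈ , refl | _ , v∈ , refl = ~-sym (cl u∈ v∈)

≤-fwd : ∀ {D P u v} → 1 ≤ D → Close D P → u ∈ P → v ∈ P → proj₁ u ≤ proj₁ v → proj₂ u ≤ proj₂ v
≤-fwd {D} {u = u} {v} 1≤D cl u∈ v∈ le = m∸n≡0⇒m≤n (0~⇒0 1≤D (subst (_~[ D ] (proj₂ u ∸ proj₂ v)) (m≤n⇒m∸n≡0 le) (cl u∈ v∈)))

≤-bwd : ∀ {D P u v} → 1 ≤ D → Close D P → u ∈ P → v ∈ P → proj₂ u ≤ proj₂ v → proj₁ u ≤ proj₁ v
≤-bwd {D} {u = u} {v} 1≤D cl u∈ v∈ le = m∸n≡0⇒m≤n (0~⇒0 1≤D (subst (_~[ D ] (proj₁ u ∸ proj₁ v)) (m≤n⇒m∸n≡0 le) (~-sym (cl u∈ v∈))))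

nearest-below : ∀ (P : Points) a {o} → o ∈ P → proj₁ o ≤ a →
                ∃ λ l → l ∈ P × proj₁ l ≤ a × (∀ {v} → v ∈ P → proj₁ v ≤ a → proj₁ v ≤ proj₁ l)
nearest-below P a {o} o∈ o≤ = l , proj₁ member , proj₂ member , λ v∈ v≤ → All.lookup (f[xs]≤f[argmax] o Q) (∈-filter⁺ low? v∈ v≤)
  where
  low? : ∀ (u : ℕ × ℕ) → Dec (proj₁ u ≤ a)
  low? u = proj₁ u ≤? a
  Q = filter low? P
  -- `o` is the default value; it is itself a point of `P` below `a`, so the result qualifies either
  -- way.
  l = argmax proj₁ o Q
  member : l ∈ P × proj₁ l ≤ a
  member with argmax-sel proj₁ o Q
  ... | inj₁ e = subst (λ t → t ∈ P × proj₁ t ≤ a) (sym e) (o∈ , o≤)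
  ... | inj₂ m = ∈-filter⁻ low? m

nearest-above : ∀ (P : Points) a {o} → o ∈ P → a ≤ proj₁ o →
                ∃ λ l → l ∈ P × a ≤ proj₁ l × (∀ {v} → v ∈ P → a ≤ proj₁ v → proj₁ l ≤ proj₁ v)
nearest-above P a {o} o∈ o≤ = l , proj₁ member , proj₂ member , λ v∈ v≤ → All.lookup (f[argmin]≤f[xs] o Q) (∈-filter⁺ high? v∈ v≤)
  where
  high? : ∀ (u : ℕ × ℕ) → Dec (a ≤ proj₁ u)
  high? u = a ≤? proj₁ u
  Q = filter high? P
  l = argmin proj₁ o Q
  member : l ∈ P × a ≤ proj₁ l
  member with argmin-sel proj₁ o Q
  ... | inj₁ e = subst (λ t → t ∈ P × a ≤ proj₁ t) (sym e) (o∈ , o≤)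
  ... | inj₂ m = ∈-filter⁻ high? m

gap-split : ∀ {i j k} → i ≤ j → j ≤ k → k ∸ i ≡ (j ∸ i) + (k ∸ j)
gap-split {i} {j} {k} i≤j j≤k = +-cancelˡ-≡ i _ _ (begin
  i + (k ∸ i)               ≡⟨ m+[n∸m]≡n (≤-trans i≤j j≤k) ⟩
  k                         ≡⟨ m+[n∸m]≡n j≤k ⟨
  j + (k ∸ j)               ≡⟨ cong (_+ (k ∸ j)) (m+[n∸m]≡n i≤j) ⟨
  i + (j ∸ i) + (k ∸ j)     ≡⟨ +-assoc i _ _ ⟩
  i + ((j ∸ i) + (k ∸ j))   ∎)
  where open ≡-Reasoning

-- The duplicator's answer keeps the two gaps next to the new point, hence all gaps, equal up to D.
answer : ∀ D P a {o t} → 1 ≤ D → Close (2 * D) P → o ∈ P → t ∈ P → proj₁ o ≤ a → a ≤ proj₁ t →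
         ∃ λ a′ → Close D ((a , a′) ∷ P)
answer D P a 1≤D cl o∈ t∈ o≤a a≤t with nearest-below P a o∈ o≤a | nearest-above P a t∈ a≤t
... | (l , l′) , l∈ , l≤a , l-max | (h , h′) , h∈ , a≤h , h-min
  with ~-split D (a ∸ l) (h ∸ a) (h′ ∸ l′) (subst (_~[ 2 * D ] (h′ ∸ l′)) (gap-split l≤a a≤h) (cl h∈ l∈))
... | x , y , x+y≡ , x~ , y~ = a′ , close
  where
  D≤2D : D ≤ 2 * D
  D≤2D = m≤m+n D _
  1≤2D : 1 ≤ 2 * D
  1≤2D = ≤-trans 1≤D D≤2D
  a′ = l′ + x
  l′≤h′ : l′ ≤ h′
  l′≤h′ = ≤-fwd 1≤2D cl l∈ h∈ (≤-trans l≤a a≤h)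
  a′+y : a′ + y ≡ h′
  a′+y = trans (+-assoc l′ x y) (trans (cong (l′ +_) x+y≡) (m+[n∸m]≡n l′≤h′))
  l′≤a′ : l′ ≤ a′
  l′≤a′ = m≤m+n l′ x
  a′≤h′ : a′ ≤ h′
  a′≤h′ = ≤-trans (m≤m+n a′ y) (≤-reflexive a′+y)
  x≡ : a′ ∸ l′ ≡ x
  x≡ = m+n∸m≡n l′ x
  y≡ : h′ ∸ a′ ≡ y
  y≡ = trans (cong (_∸ a′) (sym a′+y)) (m+n∸m≡n a′ y)
  low : ∀ {v} → v ∈ P → proj₁ v ≤ a → (a ∸ proj₁ v) ~[ D ] (a′ ∸ proj₂ v) × (proj₁ v ∸ a) ~[ D ] (proj₂ v ∸ a′)
  low {v , v′} v∈ v≤a = subst₂ (_~[ D ]_) (sym (gap-split v≤l l≤a)) (sym (gap-split v′≤l′ l′≤a′))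
      (~-+ (~-weaken D≤2D (cl l∈ v∈)) (subst ((a ∸ l) ~[ D ]_) (sym x≡) x~)) ,
      inj₁ (trans (m≤n⇒m∸n≡0 v≤a) (sym (m≤n⇒m∸n≡0 (≤-trans v′≤l′ l′≤a′))))
    where
    v≤l = l-max v∈ v≤a
    v′≤l′ = ≤-fwd 1≤2D cl v∈ l∈ v≤l
  high : ∀ {v} → v ∈ P → a ≤ proj₁ v → (a ∸ proj₁ v) ~[ D ] (a′ ∸ proj₂ v) × (proj₁ v ∸ a) ~[ D ] (proj₂ v ∸ a′)
  high {v , v′} v∈ a≤v = inj₁ (trans (m≤n⇒m∸n≡0 a≤v) (sym (m≤n⇒m∸n≡0 (≤-trans a′≤h′ h′≤v′)))) ,
      subst₂ (_~[ D ]_) (sym (gap-split a≤h h≤v)) (sym (gap-split a′≤h′ h′≤v′))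
        (~-+ (subst ((h ∸ a) ~[ D ]_) (sym y≡) y~) (~-weaken D≤2D (cl v∈ h∈)))
    where
    h≤v = h-min v∈ a≤v
    h′≤v′ = ≤-fwd 1≤2D cl h∈ v∈ h≤v
  versus : ∀ {v} → v ∈ P → (a ∸ proj₁ v) ~[ D ] (a′ ∸ proj₂ v) × (proj₁ v ∸ a) ~[ D ] (proj₂ v ∸ a′)
  versus {v} v∈ with ≤-total (proj₁ v) a
  ... | inj₁ p = low v∈ p
  ... | inj₂ p = high v∈ p
  close : Close D ((a , a′) ∷ P)
  close (here refl) (here refl) = inj₁ (trans (n∸n≡0 a) (sym (n∸n≡0 a′)))
  close (here refl) (there v∈)  = proj₁ (versus v∈)
  close (there u∈)  (here refl) = proj₂ (versus u∈)
  close (there u∈)  (there v∈)  = ~-weaken D≤2D (cl u∈ v∈)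

-- From games to formulas

rank : ∀ {σ N m} → Formula σ N m → ℕ
rank (eq _ _)   = 0
rank (rel _ _)  = 0
rank (num _ _)  = 0
rank (neg φ)    = rank φ
rank (conj φ ψ) = rank φ + rank ψ
-- Choosing an element means choosing its row and its column, two moves that each halve the
-- threshold.
rank (ex φ)     = 2 + rank φ

-- x and x′ lie in corresponding rows and columns of the two triangles.
record Matched (P : Points) (x x′ : ℕ) : Set where
  constructor matched
  field
    same-c : (c x , c x′) ∈ P
    same-r : (r x , r x′) ∈ P

Matched-there : ∀ {P x x′} u v → Matched P x x′ → Matched (v ∷ u ∷ P) x x′
Matched-there u v (matched a b) = matched (there (there a)) (there (there b))

Matched-swap : ∀ {P x x′} → Matched P x x′ → Matched (map swap P) x′ x
Matched-swap (matched a b) = matched (∈-map⁺ swap a) (∈-map⁺ swap b)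

q-row : ∀ {i s} → s ≤ i → q i + s < q (suc i)
q-row {i} {s} s≤i = subst (q i + s <_) (trans (+-comm (q i) (suc i)) (sym (q-suc i))) (+-monoʳ-< (q i) (s≤s s≤i))

c<⇒< : ∀ {x y} → c x < c y → x < y
c<⇒< {x} {y} lt = begin-strict
  x                 ≡⟨ proj₁ (cell x) ⟨
  q (c x) + r x     <⟨ q-row (proj₂ (cell x)) ⟩
  q (suc (c x))     ≤⟨ q-mono lt ⟩
  q (c y)           ≤⟨ m≤m+n _ (r y) ⟩
  q (c y) + r y     ≡⟨ proj₁ (cell y) ⟩
  y                 ∎
  where open ≤-Reasoning

cell-injective : ∀ {x y} → c x ≡ c y → r x ≡ r y → x ≡ y
cell-injective {x} {y} e e′ = trans (sym (proj₁ (cell x))) (trans (cong₂ (λ a b → q a + b) e e′) (proj₁ (cell y)))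

<⟺lex : ∀ x y → (x < y) ⟺ (c x < c y ⊎ (c x ≡ c y × r x < r y))
<⟺lex x y = to , from
  where
  to : x < y → c x < c y ⊎ (c x ≡ c y × r x < r y)
  to x<y with <-cmp (c x) (c y)
  ... | tri< lt _ _ = inj₁ lt
  ... | tri> _ _ gt = ⊥-elim (<-asym x<y (c<⇒< gt))
  ... | tri≈ _ e _  = inj₂ (e , +-cancelˡ-< (q (c y)) (r x) (r y)
        (subst₂ _<_ (trans (sym (proj₁ (cell x))) (cong (λ t → q t + r x) e)) (sym (proj₁ (cell y))) x<y))
  from : c x < c y ⊎ (c x ≡ c y × r x < r y) → x < y
  from (inj₁ lt)       = c<⇒< lt
  from (inj₂ (e , lt)) = subst₂ _<_ (trans (cong (λ t → q t + r x) (sym e)) (proj₁ (cell x))) (proj₁ (cell y)) (+-monoʳ-< (q (c y)) lt)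

module _ {D : ℕ} {P : Points} (1≤D : 1 ≤ D) (cl : Close D P) where

  <-same : ∀ {u v} → u ∈ P → v ∈ P → (proj₁ u < proj₁ v) ⟺ (proj₂ u < proj₂ v)
  <-same u∈ v∈ = (λ lt → ≰⇒> λ le → <⇒≱ lt (≤-bwd 1≤D cl v∈ u∈ le)) , λ lt → ≰⇒> λ le → <⇒≱ lt (≤-fwd 1≤D cl v∈ u∈ le)

  ≡-same : ∀ {u v} → u ∈ P → v ∈ P → (proj₁ u ≡ proj₁ v) ⟺ (proj₂ u ≡ proj₂ v)
  ≡-same u∈ v∈ =
    (λ e → ≤-antisym (≤-fwd 1≤D cl u∈ v∈ (≤-reflexive e)) (≤-fwd 1≤D cl v∈ u∈ (≤-reflexive (sym e)))) ,
    (λ e → ≤-antisym (≤-bwd 1≤D cl u∈ v∈ (≤-reflexive e)) (≤-bwd 1≤D cl v∈ u∈ (≤-reflexive (sym e))))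

  ⊎×-map : ∀ {A A′ B B′ C C′ : Set} → A ⟺ A′ → B ⟺ B′ → C ⟺ C′ → (A ⊎ (B × C)) ⟺ (A′ ⊎ (B′ × C′))
  ⊎×-map (f , f′) (g , g′) (h , h′) =
    (λ { (inj₁ a) → inj₁ (f a) ; (inj₂ (b , c)) → inj₂ (g b , h c) }) ,
    (λ { (inj₁ a) → inj₁ (f′ a) ; (inj₂ (b , c)) → inj₂ (g′ b , h′ c) })

  matched-≡ : ∀ {x x′ y y′} → Matched P x x′ → Matched P y y′ → (x ≡ y) ⟺ (x′ ≡ y′)
  matched-≡ (matched cx rx) (matched cy ry) =
    (λ { refl → cell-injective (proj₁ (≡-same cx cy) refl) (proj₁ (≡-same rx ry) refl) }) ,
    (λ { refl → cell-injective (proj₂ (≡-same cx cy) refl) (proj₂ (≡-same rx ry) refl) })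

  matched-< : ∀ {x x′ y y′} → Matched P x x′ → Matched P y y′ → (x < y) ⟺ (x′ < y′)
  matched-< {x} {x′} {y} {y′} (matched cx rx) (matched cy ry) =
    ⟺-trans (<⟺lex x y) (⟺-trans (⊎×-map (<-same cx cy) (≡-same cx cy) (<-same rx ry)) (⟺-sym (<⟺lex x′ y′)))

  matched-⊏ : ∀ {x x′ y y′} → Matched P x x′ → Matched P y y′ → (x ⊏ y) ⟺ (x′ ⊏ y′)
  matched-⊏ (matched cx rx) (matched cy ry) = ⊎×-map (<-same rx ry) (≡-same rx ry) (<-same cx cy)

-- The universe consists of the full rows 0 to `K ∸ 1`. The points 0 and `K` act as end markers: the
-- answer to a row below `K` is a row below `K′`.
record Board (P : Points) (n n′ : ℕ) : Set where
  field
    K K′  : ℕ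
    size  : suc n ≡ q K
    size′ : suc n′ ≡ q K′
    start : (0 , 0) ∈ P
    end   : (K , K′) ∈ P

Board-swap : ∀ {P n n′} → Board P n n′ → Board (map swap P) n′ n
Board-swap b = record { K = K′ ; K′ = K ; size = size′ ; size′ = size ; start = ∈-map⁺ swap start ; end = ∈-map⁺ swap end }
  where open Board b

Board-there : ∀ {P n n′} u → Board P n n′ → Board (u ∷ P) n n′
Board-there u b = record { K = K ; K′ = K′ ; size = size ; size′ = size′ ; start = there start ; end = there end }
  where open Board b

-- Rows and columns are points of the same list, so `r x ≤ c x` is among the preserved comparisons
-- and the two answers form a cell again.
move : ∀ D P n n′ → 1 ≤ D → Close (2 * (2 * D)) P → Board P n n′ → ∀ x → x ≤ n →
       ∃ λ x′ → x′ ≤ n′ × ∃ λ u → ∃ λ v → Close D (v ∷ u ∷ P) × Matched (v ∷ u ∷ P) x x′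
move D P n n′ 1≤D cl b x x≤n = respond (answer (2 * D) P (c x) 1≤2D cl start end z≤n (<⇒≤ c<K))
  where
  open Board b
  1≤2D : 1 ≤ 2 * D
  1≤2D = ≤-trans 1≤D (m≤m+n D _)
  c<K : c x < K
  c<K = ≰⇒> λ K≤c → <⇒≱ (≤-reflexive size) (≤-trans (q-mono K≤c) (≤-trans (≤-trans (m≤m+n _ (r x)) (≤-reflexive (proj₁ (cell x)))) x≤n))
  respond : (∃ λ a′ → Close (2 * D) ((c x , a′) ∷ P)) →
            ∃ λ x′ → x′ ≤ n′ × ∃ λ u → ∃ λ v → Close D (v ∷ u ∷ P) × Matched (v ∷ u ∷ P) x x′
  -- The row just placed is the upper bound for the column.
  respond (a′ , cl₁) with answer D ((c x , a′) ∷ P) (r x) 1≤D cl₁ (there start) (here refl) z≤n (proj₂ (cell x))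
  ... | b′ , cl₂ = q a′ + b′ , <⇒≤pred (subst (q a′ + b′ <_) (sym size′) (<-≤-trans (q-row b′≤a′) (q-mono a′<K′))) ,
        (c x , a′) , (r x , b′) , cl₂ ,
        matched (there (here (cong (c x ,_) (c-unique a′ b′ b′≤a′)))) (here (cong (r x ,_) (r-unique a′ b′ b′≤a′)))
    where
    b′≤a′ : b′ ≤ a′
    b′≤a′ = ≤-fwd 1≤D cl₂ (here refl) (there (here refl)) (proj₂ (cell x))
    a′<K′ : a′ < K′
    a′<K′ = proj₁ (<-same 1≤2D cl₁ (here refl) (there end)) c<K

anyFin-agree : ∀ {k l} {f : Fin k → Bool} {g : Fin l → Bool} → (∀ i → ∃ λ j → f i ≡ g j) → (∀ j → ∃ λ i → f i ≡ g j) →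
               anyFin k f ≡ anyFin l g
anyFin-agree {k} {l} {f} {g} there′ back = true⟺⇒≡
  ((λ t → let (i , p) = proj₁ (anyFin-true k f) t ; (j , e) = there′ i in proj₂ (anyFin-true l g) (j , trans (sym e) p)) ,
   (λ t → let (j , p) = proj₁ (anyFin-true l g) t ; (i , e) = back j in proj₂ (anyFin-true k f) (i , trans e p)))

-- Threshold `2 ^ d` pays for rank `d`: the two factors 2 spent by `move` are the 2 in
-- `rank (ex φ)`. Moves on the second board are answered by exchanging the boards.
eval-agree : ∀ {m} (φ : Formula [] LtSq m) d → rank φ ≤ d → ∀ P n n′ (A : Structure [] n) (A′ : Structure [] n′)
             (ρ : Fin m → Fin (suc n)) (ρ′ : Fin m → Fin (suc n′)) → Close (2 ^ d) P → Board P n n′ →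
             (∀ i → Matched P (toℕ (ρ i)) (toℕ (ρ′ i))) → eval n A ρ φ ≡ eval n′ A′ ρ′ φ
eval-agree (eq x y) d _ P n n′ A A′ ρ ρ′ cl b h = true⟺⇒≡ (⟺-trans (≡ᵇ-true (toℕ (ρ x)) (toℕ (ρ y)))
  (⟺-trans (matched-≡ (m^n>0 2 d) cl (h x) (h y)) (⟺-sym (≡ᵇ-true (toℕ (ρ′ x)) (toℕ (ρ′ y))))))
eval-agree (num fz (x ∷ y ∷ [])) d _ P n n′ A A′ ρ ρ′ cl b h = true⟺⇒≡ (⟺-trans (<ᵇ-true (toℕ (ρ x)) (toℕ (ρ y)))
  (⟺-trans (matched-< (m^n>0 2 d) cl (h x) (h y)) (⟺-sym (<ᵇ-true (toℕ (ρ′ x)) (toℕ (ρ′ y))))))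
eval-agree (num (fs fz) (x ∷ y ∷ [])) d _ P n n′ A A′ ρ ρ′ cl b h = true⟺⇒≡ (⟺-trans (⊏ᵇ-true (toℕ (ρ x)) (toℕ (ρ y)))
  (⟺-trans (matched-⊏ (m^n>0 2 d) cl (h x) (h y)) (⟺-sym (⊏ᵇ-true (toℕ (ρ′ x)) (toℕ (ρ′ y))))))
eval-agree (neg φ) d d≥ P n n′ A A′ ρ ρ′ cl b h = cong not (eval-agree φ d d≥ P n n′ A A′ ρ ρ′ cl b h)
eval-agree (conj φ ψ) d d≥ P n n′ A A′ ρ ρ′ cl b h = cong₂ _∧_
  (eval-agree φ d (≤-trans (m≤m+n _ (rank ψ)) d≥) P n n′ A A′ ρ ρ′ cl b h)
  (eval-agree ψ d (≤-trans (m≤n+m _ (rank φ)) d≥) P n n′ A A′ ρ ρ′ cl b h)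
eval-agree (ex φ) (suc (suc d)) (s≤s (s≤s d≥)) P n n′ A A′ ρ ρ′ cl b h =
  anyFin-agree {suc n} {suc n′} {λ i → eval n A (extend ρ i) φ} {λ j → eval n′ A′ (extend ρ′ j) φ} forth back
  where
  Reply : Points → ℕ → ℕ → Set
  Reply P n′ x = ∃ λ x′ → x′ ≤ n′ × ∃ λ u → ∃ λ v → Close (2 ^ d) (v ∷ u ∷ P) × Matched (v ∷ u ∷ P) x x′
  forth′ : ∀ i → Reply P n′ (toℕ i) → ∃ λ j → eval n A (extend ρ i) φ ≡ eval n′ A′ (extend ρ′ j) φ
  forth′ i (x′ , x′≤ , u , v , cl′ , mat) = fromℕ< (s≤s x′≤) ,
      eval-agree φ d d≥ (v ∷ u ∷ P) n n′ A A′ (extend ρ i) (extend ρ′ (fromℕ< (s≤s x′≤))) cl′ (Board-there v (Board-there u b))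
        λ { fz     → subst (Matched (v ∷ u ∷ P) (toℕ i)) (sym (toℕ-fromℕ< (s≤s x′≤))) mat
          ; (fs k) → Matched-there u v (h k) }
  forth : ∀ i → ∃ λ j → eval n A (extend ρ i) φ ≡ eval n′ A′ (extend ρ′ j) φ
  forth i = forth′ i (move (2 ^ d) P n n′ (m^n>0 2 d) cl b (toℕ i) (<⇒≤pred (toℕ<n i)))
  back′ : ∀ j → Reply (map swap P) n (toℕ j) → ∃ λ i → eval n A (extend ρ i) φ ≡ eval n′ A′ (extend ρ′ j) φ
  back′ j (x , x≤ , u , v , cl′ , mat) = fromℕ< (s≤s x≤) ,
      sym (eval-agree φ d d≥ (v ∷ u ∷ map swap P) n′ n A′ A (extend ρ′ j) (extend ρ (fromℕ< (s≤s x≤))) cl′ (Board-there v (Board-there u (Board-swap b)))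
        λ { fz     → subst (Matched (v ∷ u ∷ map swap P) (toℕ j)) (sym (toℕ-fromℕ< (s≤s x≤))) mat
          ; (fs k) → Matched-there u v (Matched-swap (h k)) })
  back : ∀ j → ∃ λ i → eval n A (extend ρ i) φ ≡ eval n′ A′ (extend ρ′ j) φ
  back j = back′ j (move (2 ^ d) (map swap P) n′ n (m^n>0 2 d) (Close-swap cl) (Board-swap b) (toℕ j) (<⇒≤pred (toℕ<n j)))

-- Separation by the parity of the largest element

abstract
  -- A formula reaches `n` as the element with nothing above it.
  oddᵈ : Def [] 0 0 (λ n e → bitᵇ n 0 ≡ true)
  oddᵈ = respᵈ (λ n e _ _ → to n , λ p → n , ≤-refl , (λ a a≤ n<a → <⇒≱ n<a a≤) , 0 , z≤n , refl , one p)
    (∃ᵈ (∀ᵈ (¬ᵈ (v₁ <ᵈ v₀)) ×ᵈ ∃ᵈ (zeroᵈ v₀ ×ᵈ bitᵈ v₁ v₀)))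
    where
    to : ∀ n → (∃≤ n λ x → (∀≤ n λ a → ¬ (x < a)) × ∃≤ n λ z → z ≡ 0 × x ∋ z) → bitᵇ n 0 ≡ true
    to n (x , x≤ , top , _ , _ , refl , m) = subst (λ t → bitᵇ t 0 ≡ true) (≤-antisym x≤ (≮⇒≥ (top n ≤-refl))) (isOne m)

-- `q (4t) = 2t(4t + 1)` is even and `q (4t + 1) = (4t + 1)(2t + 1)` is odd, so the largest elements
-- differ in parity, while both row counts are at least `t = 2 ^ rank φ`.
odd-not-definable : (φ : Sentence [] LtSq) → ¬ Equivalent φ (formula oddᵈ)
odd-not-definable φ equiv = absurd (trans (sym odd) (trans same even))
  where
  A : ∀ n → Structure [] n
  A n ()
  d = rank φ
  t = 2 ^ d
  -- Writing `t` as `suc u` keeps the polynomial identity for `M = 4t² + t - 1` free of subtraction.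
  u = pred t
  t≡ : suc u ≡ t
  t≡ = suc-pred t {{m^n≢0 2 d}}
  K = (t + t) + (t + t)
  M M′ n n′ : ℕ
  M  = 4 * (u * u) + 9 * u + 4
  M′ = 4 * (t * t) + 3 * t
  n  = 1 + 2 * M
  n′ = 0 + 2 * M′
  size : suc n ≡ q K
  size = trans (trans (lemma u) (cong (λ t → (t + t) * ((t + t) + (t + t)) + (t + t)) t≡)) (sym (q-even (t + t)))
    where
    lemma : ∀ u → suc (1 + 2 * (4 * (u * u) + 9 * u + 4)) ≡ (suc u + suc u) * ((suc u + suc u) + (suc u + suc u)) + (suc u + suc u)
    lemma = solve-∀
  size′ : suc n′ ≡ q (suc K)
  size′ = trans (lemma t) (sym (q-odd (t + t)))
    where
    lemma : ∀ t → suc (0 + 2 * (4 * (t * t) + 3 * t)) ≡ (t + t) * suc ((t + t) + (t + t)) + suc ((t + t) + (t + t))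
    lemma = solve-∀
  P : Points
  P = (0 , 0) ∷ (K , suc K) ∷ []
  t≤K : t ≤ K
  t≤K = ≤-trans (m≤m+n t t) (m≤m+n (t + t) (t + t))
  close : Close t P
  close (here refl)         (here refl)         = inj₁ refl
  close (here refl)         (there (here refl)) = inj₁ (0∸n≡0 K)
  close (there (here refl)) (here refl)         = inj₂ (t≤K , m≤n⇒m≤1+n t≤K)
  close (there (here refl)) (there (here refl)) = inj₁ (trans (n∸n≡0 K) (sym (n∸n≡0 K)))
  board : Board P n n′
  board = record { K = K ; K′ = suc K ; size = size ; size′ = size′ ; start = here refl ; end = there (here refl) }
  same : (A n ⊨ formula oddᵈ) ≡ (A n′ ⊨ formula oddᵈ)
  same = trans (sym (equiv n (A n))) (trans (eval-agree φ d ≤-refl P n n′ (A n) (A n′) noVar noVar close board λ ()) (equiv n′ (A n′)))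
  odd : (A n ⊨ formula oddᵈ) ≡ true
  odd = proj₂ (correct oddᵈ n z≤n (A n) noVar (λ ()) λ ()) (double-bit₀ true M)
  even : (A n′ ⊨ formula oddᵈ) ≡ false
  even = ¬-not λ p → absurd (trans (sym (proj₁ (correct oddᵈ n′ z≤n (A n′) noVar (λ ()) λ ()) p)) (double-bit₀ false M′))

theorem4p1 : ((σ : Vocab) (φ : Sentence σ LtSq) → Σ (Sentence σ BitSig) (λ ψ → Equivalent φ ψ))
    × Σ Vocab (λ σ → Σ (Sentence σ BitSig) (λ ψ → (φ : Sentence σ LtSq) → ¬ Equivalent φ ψ))
theorem4p1 = (λ σ φ → translate φ , λ n A → translate-correct φ n A noVar) , [] , formula oddᵈ , odd-not-definable
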